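{- Let $\mathcal{C} = \{(-1,0), (0,2), (1,-1), (2,1)\}$. Then for every integer $n > 10$, $\mathcal{C}$ is an $n$-optimal $4$-configuration.
   Context: For $n \in \mathbb{N}$ let $I_n = \{\lfloor (2-n)/2 \rfloor, \ldots, \lfloor n/2 \rfloor\}$ and $\mathcal{B}_n = I_n \times I_n$. A configuration is a finite set $\mathcal{C} \subset \mathbb{Z}\times\mathbb{Z}$; a $q$-configuration has $|\mathcal{C}| = q$. For $Q=(x,y)$, $A(Q) = \{(x+i,y),(x,y+i),(x+i,y+i),(x+i,y-i) : i \in \mathbb{Z}\setminus\{0\}\}$ and $A(\mathcal{C}) = \bigcup_{Q\in\mathcal{C}} A(Q)$. The cover is $\mathrm{cover}_n(\mathcal{C}) = |(\mathcal{C}\cup A(\mathcal{C}))\cap \mathcal{B}_n|$. A $q$-configuration $\mathcal{C}\subset\mathcal{B}_n$ is $n$-optimal if $\mathrm{cover}_n(\mathcal{C}') \le \mathrm{cover}_n(\mathcal{C})$ for every $q$-configuration $\mathcal{C}'\subset \mathcal{B}_n$. -}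

module Defs where

open import Data.Nat as ℕ using (ℕ)
open import Data.Integer using (ℤ; +_; -[1+_]; 0ℤ; -1ℤ; _+_; _-_; _≤_; +≤+)
open import Data.Integer.DivMod using (_/ℕ_)
open import Data.Integer.Properties
  using (_≟_; +-injective; +-0-abelianGroup; +-assoc; +-monoˡ-≤; +-monoʳ-≤;
         i≤j⇒0≤j-i; i≤i+j)
open import Algebra.Properties.AbelianGroup +-0-abelianGroup
  using (xyx⁻¹≈y; ∙-cancelˡ)
open import Data.List
  using (List; []; _∷_; length; map; filter; upTo; cartesianProduct)
open import Data.List.Membership.DecPropositional using (_∈?_)
open import Data.List.Membership.Propositional using (_∈_)
open import Data.List.Membership.Propositional.Properties
  using (∈-map⁺; ∈-map⁻; ∈-upTo⁺; ∈-upTo⁻)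
open import Data.List.Relation.Binary.Subset.Propositional using (_⊆_)
open import Data.List.Relation.Unary.Any using (Any; any?)
open import Data.List.Relation.Unary.Unique.DecPropositional using (unique?)
open import Data.List.Relation.Unary.Unique.Propositional using (Unique; [])
open import Data.List.Relation.Unary.Unique.Propositional.Properties
  using (map⁺; upTo⁺; cartesianProduct⁺)
open import Data.Product using (_×_; _,_; ∃-syntax)
open import Data.Product.Properties using (≡-dec)
open import Data.Sum using (_⊎_; inj₁; inj₂; [_,_]′)
open import Level using (0ℓ)
open import Relation.Binary.Definitions using (DecidableEquality)
open import Relation.Binary.PropositionalEquality
open import Relation.Nullary.Decidable
  using (Dec; map′; ¬?; from-yes; _×-dec_; _⊎-dec_)
open import Relation.Unary using (Pred; Decidable; _∪_)

Point : Set
Point = ℤ × ℤ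

infix 4 _≟ₚ_

_≟ₚ_ : DecidableEquality Point
_≟ₚ_ = ≡-dec _≟_ _≟_

-- The integers z with a ≤ z ≤ b in increasing order (see ∈-interval⁺,
-- ∈-interval⁻ and interval-unique); the auxiliary argument is b - a.
countUp : ℤ → ℤ → List ℤ
countUp a (+ k)    = map (λ j → a + + j) (upTo (ℕ.suc k))
countUp a -[1+ _ ] = []

interval : ℤ → ℤ → List ℤ
interval a b = countUp a (b - a)

-- _/ℕ_ rounds towards -∞, so it is the floor.
I : ℕ → List ℤ
I n = interval ((+ 2 - + n) /ℕ 2) (+ n /ℕ 2)

B : ℕ → List Point
B n = cartesianProduct (I n) (I n)

-- Finite subsets of ℤ × ℤ, as duplicate-free lists.
record Configuration : Set where
  constructor config
  field
    points : List Point
    unique : Unique points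

open Configuration public

∣_∣ : Configuration → ℕ
∣ C ∣ = length (points C)

Reaches : Point → ℤ → Pred Point 0ℓ
Reaches (x , y) i P =
    P ≡ (x + i , y)
  ⊎ P ≡ (x , y + i)
  ⊎ P ≡ (x + i , y + i)
  ⊎ P ≡ (x + i , y - i)

A₁ : Point → Pred Point 0ℓ
A₁ Q P = ∃[ i ] (i ≢ 0ℤ × Reaches Q i P)

A : Configuration → Pred Point 0ℓ
A C P = Any (λ Q → A₁ Q P) (points C)

Covered : Configuration → Pred Point 0ℓ
Covered C = (_∈ points C) ∪ A C

private
  x+i-x≡i : ∀ x i → x + i - x ≡ i
  x+i-x≡i = xyx⁻¹≈y

  reaches? : ∀ Q i P → Dec (i ≢ 0ℤ × Reaches Q i P)
  reaches? (x , y) i P =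
    ¬? (i ≟ 0ℤ) ×-dec
    (P ≟ₚ (x + i , y) ⊎-dec P ≟ₚ (x , y + i) ⊎-dec
     P ≟ₚ (x + i , y + i) ⊎-dec P ≟ₚ (x + i , y - i))

-- P = (u , v) can only be reached from (x , y) by i = u - x or i = v - y.
A₁? : ∀ Q → Decidable (A₁ Q)
A₁? Q@(x , y) P@(u , v) =
  map′ [ (λ r → u - x , r) , (λ r → v - y , r) ]′ complete
    (reaches? Q (u - x) P ⊎-dec reaches? Q (v - y) P)
  where
  at : ∀ {i j} → j ≡ i → i ≢ 0ℤ × Reaches Q i P → j ≢ 0ℤ × Reaches Q j P
  at eq = subst (λ k → k ≢ 0ℤ × Reaches Q k P) (sym eq)

  complete : A₁ Q P → _ ⊎ _
  complete (i , r@(_ , inj₁ refl))               = inj₁ (at (x+i-x≡i x i) r)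
  complete (i , r@(_ , inj₂ (inj₁ refl)))        = inj₂ (at (x+i-x≡i y i) r)
  complete (i , r@(_ , inj₂ (inj₂ (inj₁ refl)))) = inj₁ (at (x+i-x≡i x i) r)
  complete (i , r@(_ , inj₂ (inj₂ (inj₂ refl)))) = inj₁ (at (x+i-x≡i x i) r)

Covered? : ∀ C → Decidable (Covered C)
Covered? C P = _∈?_ _≟ₚ_ P (points C) ⊎-dec any? (λ Q → A₁? Q P) (points C)

-- B n has no repetitions (B-unique), so this length is a cardinality.
cover : ℕ → Configuration → ℕ
cover n C = length (filter (Covered? C) (B n))

record Optimal (n q : ℕ) (C : Configuration) : Set where
  field
    size    : ∣ C ∣ ≡ q
    inBoard : points C ⊆ B n
    maximal : ∀ C′ → ∣ C′ ∣ ≡ q → points C′ ⊆ B n → cover n C′ ℕ.≤ cover n C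

private
  points₀ : List Point
  points₀ = (-1ℤ , + 0) ∷ (+ 0 , + 2) ∷ (+ 1 , -1ℤ) ∷ (+ 2 , + 1) ∷ []

C₀ : Configuration
C₀ = config points₀ (from-yes (unique? _≟ₚ_ points₀))

private
  a+[b-a]≡b : ∀ a b → a + (b - a) ≡ b
  a+[b-a]≡b a b = trans (sym (+-assoc a b _)) (xyx⁻¹≈y a b)

∈-interval⁺ : ∀ {a b z} → a ≤ z → z ≤ b → z ∈ interval a b
∈-interval⁺ {a} {b} {z} a≤z z≤b =
  go (b - a) (z - a) refl (i≤j⇒0≤j-i a≤z) (+-monoˡ-≤ _ z≤b)
  where
  go : ∀ d e → e ≡ z - a → 0ℤ ≤ e → e ≤ d → z ∈ countUp a d
  go (+ k) (+ j) e≡ _ (+≤+ j≤k) =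
    subst (_∈ countUp a (+ k)) (trans (cong (_+_ a) e≡) (a+[b-a]≡b a z))
      (∈-map⁺ (λ i → a + + i) (∈-upTo⁺ (ℕ.s≤s j≤k)))

∈-interval⁻ : ∀ {a b z} → z ∈ interval a b → a ≤ z × z ≤ b
∈-interval⁻ {a} {b} {z} = go (b - a) refl
  where
  go : ∀ d → d ≡ b - a → z ∈ countUp a d → a ≤ z × z ≤ b
  go (+ k) d≡ z∈ with ∈-map⁻ (λ i → a + + i) z∈
  ... | j , j∈ , refl =
    i≤i+j a (+ j) ,
    subst (a + + j ≤_) (trans (cong (_+_ a) d≡) (a+[b-a]≡b a b))
      (+-monoʳ-≤ a (+≤+ (ℕ.s≤s⁻¹ (∈-upTo⁻ j∈))))

interval-unique : ∀ a b → Unique (interval a b)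
interval-unique a b = go (b - a)
  where
  go : ∀ d → Unique (countUp a d)
  go (+ k)    = map⁺ (λ eq → +-injective (∙-cancelˡ a _ _ eq)) (upTo⁺ (ℕ.suc k))
  go -[1+ _ ] = []

B-unique : ∀ n → Unique (B n)
B-unique n = cartesianProduct⁺ I-unique I-unique
  where
  I-unique : Unique (I n)
  I-unique = interval-unique ((+ 2 - + n) /ℕ 2) (+ n /ℕ 2)

{-# OPTIONS --safe #-}

-- Four queens see at most 16 n - 72 squares, those of C₀ exactly that many.  Passing
-- from the n × n board to the concentric board with n + 2 rows, a queen inside the
-- smaller board sees at most 8 new squares, two for each of its lines; those of C₀
-- see 32 new squares together.  So k queens see at most 4 k n - c(k) squares as soon
-- as this holds for n = 11, 12 and, for larger n, for placements with a queen on the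
-- edge.  An edge queen sees at most 3 n squares, so that these placements reduce to
-- k - 1 queens when n ≥ c(k) - c(k - 1); the finitely many remaining boards are
-- searched.  The search rests on this: if k queens leave fewer than m of u squares
-- unseen, then one of them sees more than (u - m) / k of the squares.

module Submission where

open import Defs
open import Data.Nat using (ℕ; _>_)
open import Data.Nat hiding (parity)
open import Data.Nat.DivMod
open import Data.Nat.Divisibility using (m∣m*n; n∣m*n)
open import Data.Nat.Properties
open import Data.Nat.Tactic.RingSolver using (solve-∀)
open import Data.Bool using (Bool; true; false; T; not; if_then_else_; _∧_; _∨_)
open import Data.Bool.ListAction using (all)
open import Data.Bool.Properties using (T-∧; T-∨; T-≡)
open import Data.List using (List; []; _∷_; _++_; length; map; filter; upTo; applyUpTo; cartesianProduct; concatMap)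
open import Data.List.Membership.Propositional using (_∈_; find; lose)
open import Data.List.Membership.Propositional.Properties
open import Data.List.Properties using (map-++; length-map; length-++; length-upTo)
open import Data.List.Relation.Binary.Subset.Propositional using (_⊆_)
open import Data.List.Relation.Unary.All as All using (All; []; _∷_)
import Data.List.Relation.Unary.All.Properties as All
open import Data.List.Relation.Unary.AllPairs as AllPairs using (AllPairs; allPairs?)
import Data.List.Relation.Unary.AllPairs.Properties as AllPairs
open import Data.List.Relation.Unary.Any as Any using (Any; here; there; any?)
import Data.List.Relation.Unary.Any.Properties as Any
open import Data.List.Relation.Unary.Unique.Propositional using (Unique; []; _∷_)
open import Data.List.Relation.Unary.Unique.Propositional.Properties
  using (map⁺; upTo⁺; cartesianProduct⁺; filter⁺; ++⁺)
open import Data.Product using (_×_; _,_; proj₁; proj₂; ∃-syntax; swap)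
open import Data.Product.Properties using (≡-dec)
open import Data.Sum using (_⊎_; inj₁; inj₂)
open import Function using (_∘_; Equivalence)
open import Relation.Binary.Definitions using (DecidableEquality; tri<; tri≈; tri>)
import Relation.Binary.Definitions as Binary
open import Relation.Binary.PropositionalEquality
open import Relation.Nullary using (¬_; contradiction; yes; no)
open import Relation.Nullary.Decidable using (_⊎-dec_; _×-dec_; from-yes)
open import Relation.Unary using (Decidable)

-- Branch and bound over placements of queens

-- Each queen has a budget of 4 n squares, and two more rows raise it by 8, which is what two new
-- squares on each of four lines cost. Bounds for fewer than four queens serve only to dispose of a
-- queen on the edge of a large board. The obstacle is the amount of searching, on boards of up to
-- 28 rows. Three devices keep it small. Symmetry moves a queen on the edge into the left half of
-- the bottom row, so that the first queen has few places. On the boards with 11 and 12 rows, every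
-- placement is assigned to a concentric box that has one of the queens on its edge, so the same
-- normalisation applies there. Finally, what a candidate would see is not counted square by square:
-- it is bounded by adding the unseen squares on its four lines, and these counts are read off as
-- digits of four large numbers that are computed once per node of the search.

radix : ℕ
radix = 1024

-- The line with index k is labelled by radix ^ k - 1, so that the digits in base
-- radix of a sum of successors of labels count the lines.
data Cell : Set where
  cell : (row col dia ant : ℕ) → Cell

row col dia ant : Cell → ℕ
row (cell r c d a) = r
col (cell r c d a) = c
dia (cell r c d a) = d
ant (cell r c d a) = a

sees : Cell → Cell → Bool
sees (cell r c d a) (cell r′ c′ d′ a′) = (r ≡ᵇ r′) ∨ (c ≡ᵇ c′) ∨ (d ≡ᵇ d′) ∨ (a ≡ᵇ a′)

keepUnless : Bool → Cell → List Cell → List Cell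
keepUnless true  p ps = ps
keepUnless false p ps = p ∷ ps

unseen : Cell → List Cell → List Cell
unseen q []       = []
unseen q (p ∷ ps) = keepUnless (sees q p) p (unseen q ps)

unseenBy : List Cell → List Cell → List Cell
unseenBy []      U = U
unseenBy (q ∷ S) U = unseenBy S (unseen q U)

histogram : (Cell → ℕ) → List Cell → ℕ
histogram ℓ []       = 0
histogram ℓ (p ∷ ps) = suc (ℓ p) + histogram ℓ ps

histograms : List Cell → Cell
histograms U = cell (histogram row U) (histogram col U) (histogram dia U) (histogram ant U)

-- With labels one less than a power, the divisor is visibly a successor and division needs no proof
-- that it is nonzero.
digit : ℕ → ℕ → ℕ
digit h e = h / suc e % radix

-- A candidate is marked true while it is itself an unseen square.
Candidate : Set
Candidate = Bool × Cell

-- The four lines of an unseen candidate all contain the candidate itself.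
gainBound : Cell → Candidate → ℕ
gainBound (cell hr hc hd ha) (f , cell r c d a) =
  (digit hr r + digit hc c + digit hd d + digit ha a) ∸ (if f then 3 else 0)

light : ℕ → ℕ → ℕ → Cell → Candidate → Bool
light k m u h c = suc k * gainBound h c + m ≤ᵇ u

put : Bool → Candidate → List Candidate × List Candidate → List Candidate × List Candidate
put true  c (hs , ls) = hs , c ∷ ls
put false c (hs , ls) = c ∷ hs , ls

split : ℕ → ℕ → ℕ → Cell → List Candidate → List Candidate × List Candidate
split k m u h []       = [] , []
split k m u h (c ∷ cs) = put (light k m u h c) c (split k m u h cs)

mark : Cell → Candidate → Candidate
mark q (f , c) = f ∧ not (sees q c) , c

-- The candidates in the first list are heavy, those in the second light. Placements containing `h`
-- are settled in its branch, so that later branches drop `h`; light candidates never get a branch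
-- but may complete any other. `h` stays available in its own branch because placements are lists
-- that may repeat a queen.
branches : (List Cell → List Candidate → Bool) → List Cell → List Candidate × List Candidate → Bool
branches f U ([] , ls)     = true
branches f U (h ∷ hs , ls) =
  f (unseen (proj₂ h) U) (map (mark (proj₂ h)) (h ∷ hs ++ ls)) ∧ branches f U (hs , ls)

search : ℕ → ℕ → List Cell → List Candidate → Bool
search m zero    U cs = m ≤ᵇ length U
search m (suc k) U cs = branches (search m k) U (split k m (length U) (histograms U) cs)

-- Seen squares and line counts

⟦_⟧ : Bool → ℕ
⟦ true ⟧  = 1
⟦ false ⟧ = 0

seenCount : Cell → List Cell → ℕ
seenCount q []       = 0
seenCount q (p ∷ ps) = ⟦ sees q p ⟧ + seenCount q ps

lineCount : (Cell → ℕ) → ℕ → List Cell → ℕ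
lineCount ℓ e []       = 0
lineCount ℓ e (p ∷ ps) = ⟦ e ≡ᵇ ℓ p ⟧ + lineCount ℓ e ps

lineCount≤length : ∀ ℓ e U → lineCount ℓ e U ≤ length U
lineCount≤length ℓ e []       = z≤n
lineCount≤length ℓ e (p ∷ ps) with e ≡ᵇ ℓ p
... | true  = s≤s (lineCount≤length ℓ e ps)
... | false = m≤n⇒m≤1+n (lineCount≤length ℓ e ps)

module _ (β : ℕ) .{{_ : NonZero β}} where

  IsPower : ℕ → Set
  IsPower e = ∃[ k ] suc e ≡ β ^ k

  label-< : ∀ {e f j k} → suc e ≡ β ^ j → suc f ≡ β ^ k → j < k →
            ∃[ x ] suc f ≡ suc e * (β * x)
  label-< {e} {f} {j} {k} e≡ f≡ j<k = β ^ (k ∸ suc j) , (begin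
    suc f                        ≡⟨ f≡ ⟩
    β ^ k                        ≡⟨ cong (β ^_) (m+[n∸m]≡n j<k) ⟨
    β ^ (suc j + (k ∸ suc j))    ≡⟨ ^-distribˡ-+-* β (suc j) (k ∸ suc j) ⟩
    β * β ^ j * x                ≡⟨ cong (_* x) (*-comm β (β ^ j)) ⟩
    β ^ j * β * x                ≡⟨ *-assoc (β ^ j) β x ⟩
    β ^ j * (β * x)              ≡⟨ cong (_* (β * x)) e≡ ⟨
    suc e * (β * x)              ∎)
    where
    open ≡-Reasoning
    x = β ^ (k ∸ suc j)

  -- The digits of the histogram below, at and above the position of e.
  histogram-digits : ∀ ℓ e U → IsPower e → All (IsPower ∘ ℓ) U →
    ∃[ lo ] ∃[ hi ] histogram ℓ U ≡ lo + suc e * (lineCount ℓ e U + β * hi)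
                  × lo * β ≤ length U * suc e
  histogram-digits ℓ e []       _ _ = 0 , 0 , sym (trans (cong (suc e *_) (*-zeroʳ β)) (*-zeroʳ (suc e))) , z≤n
  histogram-digits ℓ e (p ∷ ps) (j , e≡) ((k , p≡) ∷ labels)
    with histogram-digits ℓ e ps (j , e≡) labels | e ≡ᵇ ℓ p in eq
  ... | lo , hi , h≡ , lo≤ | true =
    lo , hi ,
    trans (cong₂ (λ x y → suc x + y) (sym (≡ᵇ⇒≡ e (ℓ p) (subst T (sym eq) _))) h≡)
          (rearrange (suc e) lo (lineCount ℓ e ps + β * hi)) ,
    ≤-trans lo≤ (m≤n+m _ (suc e))
    where
    rearrange : ∀ s l x → s + (l + s * x) ≡ l + s * (1 + x)
    rearrange = solve-∀
  ... | lo , hi , h≡ , lo≤ | false with <-cmp j k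
  ... | tri< j<k _ _ =
    let x , x≡ = label-< e≡ p≡ j<k in
    lo , hi + x ,
    trans (cong₂ _+_ x≡ h≡) (rearrange (suc e) lo (lineCount ℓ e ps) β hi x) ,
    ≤-trans lo≤ (m≤n+m _ (suc e))
    where
    rearrange : ∀ s l c b hi x → s * (b * x) + (l + s * (c + b * hi)) ≡ l + s * (c + b * (hi + x))
    rearrange = solve-∀
  ... | tri≈ _ j≡k _ =
    contradiction (≡⇒≡ᵇ e (ℓ p) (suc-injective (trans e≡ (trans (cong (β ^_) j≡k) (sym p≡)))))
                  (subst (¬_ ∘ T) (sym eq) (λ ()))
  -- A label below `e` belongs to a smaller power, so `β` times its successor is at most `suc e`:
  -- the element `p` itself pays for the growth of `lo`.
  ... | tri> _ _ k<j =
    let x , x≡ = label-< p≡ e≡ k<j in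
    suc (ℓ p) + lo , hi ,
    trans (cong (suc (ℓ p) +_) h≡) (sym (+-assoc (suc (ℓ p)) lo _)) ,
    (begin
      (suc (ℓ p) + lo) * β        ≡⟨ *-distribʳ-+ β (suc (ℓ p)) lo ⟩
      suc (ℓ p) * β + lo * β      ≤⟨ +-mono-≤ (step x x≡) lo≤ ⟩
      suc e + length ps * suc e   ∎)
    where
    open ≤-Reasoning
    step : ∀ x → suc e ≡ suc (ℓ p) * (β * x) → suc (ℓ p) * β ≤ suc e
    step zero    x≡ = contradiction (trans x≡ (trans (cong (suc (ℓ p) *_) (*-zeroʳ β)) (*-zeroʳ (suc (ℓ p))))) λ ()
    step (suc x) x≡ = ≤-trans (*-monoʳ-≤ (suc (ℓ p)) (m≤m*n β (suc x))) (≤-reflexive (sym x≡))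

  -- There are no carries: with fewer than `β` entries, the lower positions sum to less than
  -- `suc e`, and the count itself is less than `β`.
  nth-digit : ∀ ℓ e U → length U < β → IsPower e → All (IsPower ∘ ℓ) U →
              histogram ℓ U / suc e % β ≡ lineCount ℓ e U
  nth-digit ℓ e U small e-label labels with histogram-digits ℓ e U e-label labels
  ... | lo , hi , h≡ , lo≤ = begin
    histogram ℓ U / suc e % β                ≡⟨ cong (λ h → h / suc e % β) h≡ ⟩
    (lo + suc e * x) / suc e % β             ≡⟨ cong (_% β) (+-distrib-/-∣ʳ lo (m∣m*n x)) ⟩
    (lo / suc e + suc e * x / suc e) % β     ≡⟨ cong₂ (λ y z → (y + z) % β) (m<n⇒m/n≡0 lo<) (m*n/m≡n (suc e) x) ⟩
    (lineCount ℓ e U + β * hi) % β           ≡⟨ cong (λ y → (lineCount ℓ e U + y) % β) (*-comm β hi) ⟩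
    (lineCount ℓ e U + hi * β) % β           ≡⟨ [m+kn]%n≡m%n (lineCount ℓ e U) hi β ⟩
    lineCount ℓ e U % β                      ≡⟨ m<n⇒m%n≡m (≤-<-trans (lineCount≤length ℓ e U) small) ⟩
    lineCount ℓ e U                              ∎
    where
    open ≡-Reasoning
    x = lineCount ℓ e U + β * hi
    lo< : lo < suc e
    lo< = *-cancelʳ-< β lo (suc e)
      (≤-<-trans lo≤ (subst (length U * suc e <_) (*-comm β (suc e)) (*-monoˡ-< (suc e) small)))
    m*n/m≡n : ∀ m n .{{_ : NonZero m}} → m * n / m ≡ n
    m*n/m≡n m n = trans (cong (_/ m) (*-comm m n)) (m*n/n≡m n m)

IsLabel : ℕ → Set
IsLabel = IsPower radix

IsCell : Cell → Set
IsCell (cell r c d a) = IsLabel r × IsLabel c × IsLabel d × IsLabel a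

digit≡lineCount : ∀ ℓ e U → length U < radix → IsLabel e → All (IsLabel ∘ ℓ) U →
                  digit (histogram ℓ U) e ≡ lineCount ℓ e U
digit≡lineCount = nth-digit radix

lines : Cell → List Cell → ℕ
lines (cell r c d a) U = lineCount row r U + lineCount col c U + lineCount dia d U + lineCount ant a U

⟦∨⟧ : ∀ x y z w → ⟦ x ∨ y ∨ z ∨ w ⟧ ≤ ⟦ x ⟧ + ⟦ y ⟧ + ⟦ z ⟧ + ⟦ w ⟧
⟦∨⟧ true  _     _     _ = s≤s z≤n
⟦∨⟧ false true  _     _ = s≤s z≤n
⟦∨⟧ false false true  _ = s≤s z≤n
⟦∨⟧ false false false w = ≤-refl

private
  interchange : ∀ x y z w x′ y′ z′ w′ →
    (x + y + z + w) + (x′ + y′ + z′ + w′) ≡ (x + x′) + (y + y′) + (z + z′) + (w + w′)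
  interchange = solve-∀

seenCount≤lines : ∀ q U → seenCount q U ≤ lines q U
seenCount≤lines q              []       = z≤n
seenCount≤lines q@(cell r c d a) (p@(cell r′ c′ d′ a′) ∷ ps) =
  ≤-trans (+-mono-≤ (⟦∨⟧ (r ≡ᵇ r′) (c ≡ᵇ c′) (d ≡ᵇ d′) (a ≡ᵇ a′)) (seenCount≤lines q ps))
          (≤-reflexive (interchange ⟦ r ≡ᵇ r′ ⟧ _ _ _ (lineCount row r ps) _ _ _))

≡ᵇ-refl : ∀ n → (n ≡ᵇ n) ≡ true
≡ᵇ-refl n = Equivalence.to T-≡ (≡⇒≡ᵇ n n refl)

seenCount+3≤lines : ∀ q {U} → q ∈ U → seenCount q U + 3 ≤ lines q U
seenCount+3≤lines q@(cell r c d a) {p ∷ ps} (here refl)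
  rewrite ≡ᵇ-refl r | ≡ᵇ-refl c | ≡ᵇ-refl d | ≡ᵇ-refl a =
  ≤-trans (≤-reflexive (+-comm (suc (seenCount q ps)) 3))
  (≤-trans (+-monoʳ-≤ 4 (seenCount≤lines q ps))
           (≤-reflexive (interchange 1 1 1 1 (lineCount row r ps) _ _ _)))
seenCount+3≤lines q@(cell r c d a) {p@(cell r′ c′ d′ a′) ∷ ps} (there q∈) =
  ≤-trans (≤-reflexive (+-assoc ⟦ sees q p ⟧ _ 3))
  (≤-trans (+-mono-≤ (⟦∨⟧ (r ≡ᵇ r′) (c ≡ᵇ c′) (d ≡ᵇ d′) (a ≡ᵇ a′)) (seenCount+3≤lines q q∈))
           (≤-reflexive (interchange ⟦ r ≡ᵇ r′ ⟧ _ _ _ (lineCount row r ps) _ _ _)))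

gainBound≡lines : ∀ U f q → length U < radix → All IsCell U → IsCell q →
                  gainBound (histograms U) (f , q) ≡ lines q U ∸ (if f then 3 else 0)
gainBound≡lines U f (cell r c d a) small cells (r-lab , c-lab , d-lab , a-lab) =
  cong (_∸ (if f then 3 else 0)) (cong₂ _+_ (cong₂ _+_ (cong₂ _+_
    (digit≡lineCount row r U small r-lab (All.map (λ { {cell _ _ _ _} → proj₁ }) cells))
    (digit≡lineCount col c U small c-lab (All.map (λ { {cell _ _ _ _} → proj₁ ∘ proj₂ }) cells)))
    (digit≡lineCount dia d U small d-lab (All.map (λ { {cell _ _ _ _} → proj₁ ∘ proj₂ ∘ proj₂ }) cells)))
    (digit≡lineCount ant a U small a-lab (All.map (λ { {cell _ _ _ _} → proj₂ ∘ proj₂ ∘ proj₂ }) cells)))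

-- The mark `true` lowers the bound by 3 and so must certify that the queen's square is unseen; the
-- mark `false` is always safe.
seenCount≤gainBound : ∀ U f q → length U < radix → All IsCell U → IsCell q → (T f → q ∈ U) →
                      seenCount q U ≤ gainBound (histograms U) (f , q)
seenCount≤gainBound U f q small cells q-cell f⇒∈ =
  subst (seenCount q U ≤_) (sym (gainBound≡lines U f q small cells q-cell)) (bound f f⇒∈)
  where
  bound : ∀ f → (T f → q ∈ U) → seenCount q U ≤ lines q U ∸ (if f then 3 else 0)
  bound true  q∈ = m+n≤o⇒m≤o∸n (seenCount q U) (seenCount+3≤lines q (q∈ _))
  bound false _  = seenCount≤lines q U

-- What several queens leave unseen

length-unseen : ∀ q U → length (unseen q U) + seenCount q U ≡ length U
length-unseen q []       = refl
length-unseen q (p ∷ ps) with sees q p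
... | true  = trans (+-suc _ _) (cong suc (length-unseen q ps))
... | false = cong suc (length-unseen q ps)

length-unseen≤ : ∀ q U → length (unseen q U) ≤ length U
length-unseen≤ q U = ≤-trans (m≤m+n _ _) (≤-reflexive (length-unseen q U))

seenCount-unseen : ∀ p q U → seenCount p (unseen q U) ≤ seenCount p U
seenCount-unseen p q []       = z≤n
seenCount-unseen p q (r ∷ rs) with sees q r
... | true  = ≤-trans (seenCount-unseen p q rs) (m≤n+m _ _)
... | false = +-monoʳ-≤ _ (seenCount-unseen p q rs)

unseen-comm : ∀ p q U → unseen p (unseen q U) ≡ unseen q (unseen p U)
unseen-comm p q []       = refl
unseen-comm p q (r ∷ rs) with sees p r in p-r | sees q r in q-r
... | true  | true  = unseen-comm p q rs
... | true  | false rewrite p-r = unseen-comm p q rs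
... | false | true  rewrite q-r = unseen-comm p q rs
... | false | false rewrite p-r | q-r = cong (r ∷_) (unseen-comm p q rs)

-- The search chooses which queen to place next, wherever it stands in the list; as removals
-- commute, that queen may go first.
unseenBy-middle : ∀ S q S′ U → unseenBy (S ++ q ∷ S′) U ≡ unseenBy (S ++ S′) (unseen q U)
unseenBy-middle []      q S′ U = refl
unseenBy-middle (p ∷ S) q S′ U =
  trans (unseenBy-middle S q S′ (unseen p U)) (cong (unseenBy (S ++ S′)) (unseen-comm q p U))

unseen-⊆ : ∀ {P : Cell → Set} q {U} → All P U → All P (unseen q U)
unseen-⊆ q []             = []
unseen-⊆ q {p ∷ _} (Pp ∷ Pps) with sees q p
... | true  = unseen-⊆ q Pps
... | false = Pp ∷ unseen-⊆ q Pps

∈-unseen : ∀ q {p U} → p ∈ U → T (not (sees q p)) → p ∈ unseen q U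
∈-unseen q {p} {r ∷ rs} (here refl) ¬seen with sees q r
... | false = here refl
∈-unseen q {p} {r ∷ rs} (there p∈) ¬seen with sees q r
... | true  = ∈-unseen q p∈ ¬seen
... | false = there (∈-unseen q p∈ ¬seen)

-- The sum of the premises over S, with terms moved so that nothing is subtracted.
light-bound : ∀ k m u S U → length U ≤ u →
  All (λ q → k * seenCount q U + m ≤ u) S →
  k * length U + length S * m ≤ k * length (unseenBy S U) + length S * u
light-bound k m u []      U _  []             = ≤-refl
light-bound k m u (q ∷ S) U U≤ (q-light ∷ lights) = begin
  k * length U + (m + length S * m)                          ≡⟨ cong (λ x → k * x + (m + length S * m)) (length-unseen q U) ⟨
  k * (length V + seenCount q U) + (m + length S * m)        ≡⟨ rearrange k (length V) (seenCount q U) m (length S * m) ⟩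
  (k * seenCount q U + m) + (k * length V + length S * m)    ≤⟨ +-mono-≤ q-light
     -- A queen sees no more of what an earlier one has left than of `U`, so the remaining premises
     -- survive with the same `u`.
     (light-bound k m u S V (≤-trans (length-unseen≤ q U) U≤)
       (All.map (λ {p} p-light → ≤-trans (+-monoˡ-≤ m (*-monoʳ-≤ k (seenCount-unseen p q U))) p-light) lights)) ⟩
  u + (k * length (unseenBy S V) + length S * u)             ≡⟨ rearrange′ u (k * length (unseenBy S V)) (length S * u) ⟩
  k * length (unseenBy S V) + (u + length S * u)             ∎
  where
  open ≤-Reasoning
  V = unseen q U
  rearrange : ∀ k v c m x → k * (v + c) + (m + x) ≡ (k * c + m) + (k * v + x)
  rearrange = solve-∀
  rearrange′ : ∀ u x y → u + (x + y) ≡ x + (u + y)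
  rearrange′ = solve-∀

all-light : ∀ k m S U → length S ≡ suc k →
  All (λ q → suc k * seenCount q U + m ≤ length U) S → m ≤ length (unseenBy S U)
all-light k m S U len lights = *-cancelˡ-≤ K (+-cancelʳ-≤ (K * length U) _ _ (begin
  K * m + K * length U                            ≡⟨ +-comm (K * m) _ ⟩
  K * length U + K * m                            ≡⟨ cong (λ l → K * length U + l * m) len ⟨
  K * length U + length S * m                     ≤⟨ light-bound K m (length U) S U ≤-refl lights ⟩
  K * length (unseenBy S U) + length S * length U ≡⟨ cong (λ l → K * length (unseenBy S U) + l * length U) len ⟩
  K * length (unseenBy S U) + K * length U        ∎))
  where
  open ≤-Reasoning
  K = suc k

-- Soundness of the search

record Valid (U : List Cell) (cs : List Candidate) : Set where
  field
    small   : length U < radix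
    cells   : All IsCell U
    cells′  : All (IsCell ∘ proj₂) cs
    unseen! : All (λ c → T (proj₁ c) → proj₂ c ∈ U) cs

AmongCandidates : List Candidate → List Cell → Set
AmongCandidates cs = All (λ q → Any (λ c → proj₂ c ≡ q) cs)

Valid-mark : ∀ {U cs} q → Valid U cs → Valid (unseen q U) (map (mark q) cs)
Valid-mark {U} q v = record
  { small   = ≤-<-trans (length-unseen≤ q U) small
  ; cells   = unseen-⊆ q cells
  ; cells′  = All.map⁺ cells′
  ; unseen! = All.map⁺ (All.map still-unseen unseen!)
  }
  where
  open Valid v
  still-unseen : ∀ {c} → (T (proj₁ c) → proj₂ c ∈ U) → T (proj₁ (mark q c)) → proj₂ c ∈ unseen q U
  still-unseen c∈ t with Equivalence.to T-∧ t
  ... | f , ¬seen = ∈-unseen q (c∈ f) ¬seen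

Valid-⊆ : ∀ {U cs cs′} → (∀ {c} → c ∈ cs′ → c ∈ cs) → Valid U cs → Valid U cs′
Valid-⊆ sub v = record
  { small = small ; cells = cells
  ; cells′ = All.tabulate (λ c∈ → All.lookup cells′ (sub c∈))
  ; unseen! = All.tabulate (λ c∈ → All.lookup unseen! (sub c∈)) }
  where open Valid v

among-mark : ∀ q {cs S} → AmongCandidates cs S → AmongCandidates (map (mark q) cs) S
among-mark q = All.map (λ c∈ → any-map c∈)
  where
  any-map : ∀ {p cs} → Any (λ c → proj₂ c ≡ p) cs → Any (λ c → proj₂ c ≡ p) (map (mark q) cs)
  any-map (here eq) = here eq
  any-map (there a) = there (any-map a)

-- Replacing the recursive call by any `f` with this property lets the branching be treated without
-- unfolding `search`.
record Sound (k m : ℕ) (f : List Cell → List Candidate → Bool) : Set where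
  constructor sound
  field
    bound : ∀ {U cs} → Valid U cs → T (f U cs) → ∀ S → length S ≡ k → AmongCandidates cs S →
            m ≤ length (unseenBy S U)

extract : ∀ {h : Candidate} {cs} S → AmongCandidates (h ∷ cs) S →
  AmongCandidates cs S ⊎ ∃[ S₁ ] ∃[ S₂ ] S ≡ S₁ ++ proj₂ h ∷ S₂
extract []      []              = inj₁ []
extract (q ∷ S) (here refl ∷ _) = inj₂ ([] , S , refl)
extract (q ∷ S) (there q∈ ∷ S∈) with extract S S∈
... | inj₁ S∈′              = inj₁ (q∈ ∷ S∈′)
... | inj₂ (S₁ , S₂ , refl) = inj₂ (q ∷ S₁ , S₂ , refl)

length-middle : ∀ {X : Set} (xs : List X) {y ys} → length (xs ++ y ∷ ys) ≡ suc (length (xs ++ ys))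
length-middle []       = refl
length-middle (x ∷ xs) = cong suc (length-middle xs)

All-middle : ∀ {X : Set} {P : X → Set} (xs : List X) {y ys} → All P (xs ++ y ∷ ys) → P y × All P (xs ++ ys)
All-middle []       (Py ∷ Pys) = Py , Pys
All-middle (x ∷ xs) (Px ∷ Ps)  with All-middle xs Ps
... | Py , Pxs = Py , Px ∷ Pxs

branch : ∀ {k m f U cs} q S₁ {S₂} → Sound k m f → Valid U cs →
  T (f (unseen q U) (map (mark q) cs)) →
  length (S₁ ++ q ∷ S₂) ≡ suc k → AmongCandidates cs (S₁ ++ q ∷ S₂) →
  m ≤ length (unseenBy (S₁ ++ q ∷ S₂) U)
branch {m = m} {U = U} q S₁ {S₂} (sound bound) v t len S∈ =
  subst (λ V → m ≤ length V) (sym (unseenBy-middle S₁ q S₂ U))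
    (bound (Valid-mark q v) t (S₁ ++ S₂) (suc-injective (trans (sym (length-middle S₁)) len))
      (among-mark q (proj₂ (All-middle S₁ S∈))))

branches-sound : ∀ {k m f U} hs ls → Sound k m f → Valid U (hs ++ ls) → T (branches f U (hs , ls)) →
  ∀ S → length S ≡ suc k → AmongCandidates (hs ++ ls) S →
  m ≤ length (unseenBy S U) ⊎ AmongCandidates ls S
branches-sound []       ls snd v t S len S∈ = inj₂ S∈
branches-sound (h ∷ hs) ls snd v t S len S∈ with Equivalence.to T-∧ t | extract S S∈
... | t₁ , t₂ | inj₁ S∈′              = branches-sound hs ls snd (Valid-⊆ there v) t₂ S len S∈′
... | t₁ , t₂ | inj₂ (S₁ , S₂ , refl) = inj₁ (branch (proj₂ h) S₁ snd v t₁ len S∈)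

module _ (k m u : ℕ) (h : Cell) where

  split-light : ∀ cs → All (T ∘ light k m u h) (proj₂ (split k m u h cs))
  split-light []       = []
  split-light (c ∷ cs) with light k m u h c in eq
  ... | true  = subst T (sym eq) _ ∷ split-light cs
  ... | false = split-light cs

  split-⊆ : ∀ cs {c} → c ∈ proj₁ (split k m u h cs) ++ proj₂ (split k m u h cs) → c ∈ cs
  split-⊆ (c ∷ cs) c∈ with light k m u h c
  split-⊆ (c ∷ cs) c∈         | true with ∈-++⁻ (proj₁ (split k m u h cs)) c∈
  ... | inj₁ c∈hs         = there (split-⊆ cs (∈-++⁺ˡ c∈hs))
  ... | inj₂ (here eq)    = here eq
  ... | inj₂ (there c∈ls) = there (split-⊆ cs (∈-++⁺ʳ (proj₁ (split k m u h cs)) c∈ls))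
  split-⊆ (c ∷ cs) (here eq)  | false = here eq
  split-⊆ (c ∷ cs) (there c∈) | false = there (split-⊆ cs c∈)

  split-⊇ : ∀ {P : Candidate → Set} cs → Any P cs → Any P (proj₁ (split k m u h cs) ++ proj₂ (split k m u h cs))
  split-⊇ (c ∷ cs) p with light k m u h c
  split-⊇ (c ∷ cs) (here Pc) | true  = Any.++⁺ʳ (proj₁ (split k m u h cs)) (here Pc)
  split-⊇ (c ∷ cs) (there p) | true  = insert (proj₁ (split k m u h cs)) (split-⊇ cs p)
    where
    insert : ∀ {P : Candidate → Set} xs {y ys} → Any P (xs ++ ys) → Any P (xs ++ y ∷ ys)
    insert []       p         = there p
    insert (x ∷ xs) (here Px) = here Px
    insert (x ∷ xs) (there p) = there (insert xs p)
  split-⊇ (c ∷ cs) (here Pc) | false = here Pc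
  split-⊇ (c ∷ cs) (there p) | false = there (split-⊇ cs p)

search-sound : ∀ k m → Sound k m (search m k)
search-sound zero    m = sound λ { v t [] refl [] → ≤ᵇ⇒≤ m _ t }
search-sound (suc k) m = sound go
  where
  go : ∀ {U cs} → Valid U cs → T (search m (suc k) U cs) → ∀ S → length S ≡ suc k → AmongCandidates cs S →
       m ≤ length (unseenBy S U)
  go {U} {cs} v t S len S∈
    with branches-sound (proj₁ (split k m (length U) (histograms U) cs)) _ (search-sound k m)
           (Valid-⊆ (split-⊆ k m (length U) (histograms U) cs) v) t S len
           (All.map (split-⊇ k m (length U) (histograms U) cs) S∈)
  ... | inj₁ bound = bound
  ... | inj₂ S∈ls  = all-light k m S U len (All.map is-light S∈ls)
    where
    open Valid v
    ls = proj₂ (split k m (length U) (histograms U) cs)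
    light⇒ : ∀ {f q} → (f , q) ∈ ls → suc k * seenCount q U + m ≤ length U
    light⇒ {f} {q} c∈ = ≤-trans
      (+-monoˡ-≤ m (*-monoʳ-≤ (suc k) (seenCount≤gainBound U f q small cells
        (All.lookup cells′ c∈cs) (All.lookup unseen! c∈cs))))
      (≤ᵇ⇒≤ _ _ (All.lookup (split-light k m (length U) (histograms U) cs) c∈))
      where c∈cs = split-⊆ k m (length U) (histograms U) cs (∈-++⁺ʳ (proj₁ (split k m (length U) (histograms U) cs)) c∈)
    is-light : ∀ {q} → Any (λ c → proj₂ c ≡ q) ls → suc k * seenCount q U + m ≤ length U
    is-light q∈ with find q∈
    ... | _ , c∈ , refl = light⇒ c∈

-- Squares seen on a board

length-⊆ : ∀ {X : Set} {xs ys : List X} → Unique xs → xs ⊆ ys → length xs ≤ length ys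
length-⊆ []                 _  = z≤n
length-⊆ {xs = x ∷ xs} {ys} (x∉xs ∷ xs!) ⊆ys with ∈-∃++ (⊆ys (here refl))
... | zs , ws , refl = ≤-trans (s≤s (length-⊆ xs! ⊆rest)) (≤-reflexive (sym (length-middle zs)))
  where
  ⊆rest : xs ⊆ zs ++ ws
  ⊆rest z∈ with ∈-++⁻ zs (⊆ys (there z∈))
  ... | inj₁ z∈zs         = ∈-++⁺ˡ z∈zs
  ... | inj₂ (here refl)  = contradiction refl (All.lookup x∉xs z∈)
  ... | inj₂ (there z∈ws) = ∈-++⁺ʳ zs z∈ws

Square : Set
Square = ℕ × ℕ

-- Differences are compared by adding crosswise, to stay within ℕ. A square sees itself, so occupied
-- and attacked squares are treated alike.
Sees : Square → Square → Set
Sees (i , j) (u , v) = i ≡ u ⊎ j ≡ v ⊎ i + v ≡ u + j ⊎ i + j ≡ u + v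

SeenBy : List Square → Square → Set
SeenBy S p = Any (λ q → Sees q p) S

seenBy? : ∀ S → Decidable (SeenBy S)
seenBy? S (u , v) = any? (λ (i , j) → i ≟ u ⊎-dec j ≟ v ⊎-dec i + v ≟ u + j ⊎-dec i + j ≟ u + v) S

grid : ℕ → List Square
grid n = cartesianProduct (upTo n) (upTo n)

seenSquares : ℕ → List Square → List Square
seenSquares n S = filter (seenBy? S) (grid n)

seenNumber : ℕ → List Square → ℕ
seenNumber n S = length (seenSquares n S)

OnBoard : ℕ → Square → Set
OnBoard n (i , j) = i < n × j < n

∈-grid⁺ : ∀ {n p} → OnBoard n p → p ∈ grid n
∈-grid⁺ (i< , j<) = ∈-cartesianProduct⁺ (∈-upTo⁺ i<) (∈-upTo⁺ j<)

∈-grid⁻ : ∀ {n p} → p ∈ grid n → OnBoard n p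
∈-grid⁻ {n} p∈ with ∈-cartesianProduct⁻ (upTo n) (upTo n) p∈
... | i∈ , j∈ = ∈-upTo⁻ i∈ , ∈-upTo⁻ j∈

grid-unique : ∀ n → Unique (grid n)
grid-unique n = cartesianProduct⁺ (upTo⁺ n) (upTo⁺ n)

length-cartesianProduct : ∀ {X Y : Set} (xs : List X) (ys : List Y) →
                          length (cartesianProduct xs ys) ≡ length xs * length ys
length-cartesianProduct []       ys = refl
length-cartesianProduct (x ∷ xs) ys =
  trans (length-++ (map (x ,_) ys)) (cong₂ _+_ (length-map (x ,_) ys) (length-cartesianProduct xs ys))

length-grid : ∀ n → length (grid n) ≡ n * n
length-grid n = trans (length-cartesianProduct (upTo n) (upTo n)) (cong₂ _*_ (length-upTo n) (length-upTo n))

-- `ys` may repeat squares, so that the ends of several lines, or whole lines that cross, can simply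
-- be concatenated.
seenNumber≤length : ∀ n S ys → (∀ {p} → OnBoard n p → SeenBy S p → p ∈ ys) → seenNumber n S ≤ length ys
seenNumber≤length n S ys covers = length-⊆ (filter⁺ (seenBy? S) (grid-unique n)) sub
  where
  sub : seenSquares n S ⊆ ys
  sub p∈ with ∈-filter⁻ (seenBy? S) {xs = grid n} p∈
  ... | p∈grid , seen = covers (∈-grid⁻ p∈grid) seen

∈-seenSquares : ∀ {n S p} → OnBoard n p → SeenBy S p → p ∈ seenSquares n S
∈-seenSquares {S = S} p-on seen = ∈-filter⁺ (seenBy? S) (∈-grid⁺ p-on) seen

-- Codes may see too much but never too little. An extra sighting only makes fewer cells unseen,
-- which is harmless because the search bounds their number from below; hence an inequality.
length-seenBy+unseenBy : ∀ S (f : Square → Cell) G →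
  All (λ p → All (λ q → Sees q p → T (sees (f q) (f p))) S) G →
  length (filter (seenBy? S) G) + length (unseenBy (map f S) (map f G)) ≤ length G
length-seenBy+unseenBy S f G compat = go G compat
  where
  unseenBy-[] : ∀ C → unseenBy C [] ≡ []
  unseenBy-[] []      = refl
  unseenBy-[] (c ∷ C) = unseenBy-[] C

  unseenBy-∷ : ∀ C p ps → unseenBy C (p ∷ ps) ≡ unseenBy C ps ⊎
               unseenBy C (p ∷ ps) ≡ p ∷ unseenBy C ps × All (λ q → ¬ T (sees q p)) C
  unseenBy-∷ []      p ps = inj₂ (refl , [])
  unseenBy-∷ (c ∷ C) p ps with sees c p in eq
  ... | true  = inj₁ refl
  ... | false with unseenBy-∷ C p (unseen c ps)
  ... | inj₁ skip         = inj₁ skip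
  ... | inj₂ (keep , ¬ts) = inj₂ (keep , subst (¬_ ∘ T) (sym eq) (λ ()) ∷ ¬ts)

  go : ∀ G → All (λ p → All (λ q → Sees q p → T (sees (f q) (f p))) S) G →
       length (filter (seenBy? S) G) + length (unseenBy (map f S) (map f G)) ≤ length G
  go []      _ = ≤-reflexive (cong length (unseenBy-[] (map f S)))
  go (p ∷ G) (p-compat ∷ compat) with seenBy? S p | unseenBy-∷ (map f S) (f p) (map f G)
  ... | yes _    | inj₁ skip = s≤s (subst (λ U → _ + length U ≤ length G) (sym skip) (go G compat))
  ... | yes seen | inj₂ (_ , ¬ts) = contradiction seen (unseen-by-all p-compat (All.map⁻ ¬ts))
    where
    unseen-by-all : ∀ {S} → All (λ q → Sees q p → T (sees (f q) (f p))) S →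
                    All (λ q → ¬ T (sees (f q) (f p))) S → ¬ SeenBy S p
    unseen-by-all (c ∷ _)  (¬t ∷ _)  (here s)  = ¬t (c s)
    unseen-by-all (_ ∷ cs) (_ ∷ ¬ts) (there s) = unseen-by-all cs ¬ts s
  ... | no _     | inj₁ skip = m≤n⇒m≤1+n (subst (λ U → _ + length U ≤ length G) (sym skip) (go G compat))
  ... | no _     | inj₂ (keep , _) =
    subst (λ U → _ + length U ≤ suc (length G)) (sym keep)
      (≤-trans (≤-reflexive (+-suc _ _)) (s≤s (go G compat)))

-- The symmetries of the board

record Symmetry (n : ℕ) (σ : Square → Square) : Set where
  field
    onBoard    : ∀ {p} → OnBoard n p → OnBoard n (σ p)
    involutive : ∀ {p} → OnBoard n p → σ (σ p) ≡ p
    preserves  : ∀ {q p} → OnBoard n q → OnBoard n p → Sees q p → Sees (σ q) (σ p)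

-- A square `p` seen by `S` is `σ (σ p)`, and `σ p` is seen by the image. This direction carries
-- upper bounds for the image back to `S`.
seenNumber-symmetry : ∀ {n σ S} → Symmetry n σ → All (OnBoard n) S → seenNumber n S ≤ seenNumber n (map σ S)
seenNumber-symmetry {n} {σ} {S} sym-σ S-on =
  ≤-trans (seenNumber≤length n S (map σ (seenSquares n (map σ S))) covers) (≤-reflexive (length-map σ (seenSquares n (map σ S))))
  where
  open Symmetry sym-σ
  seen-image : ∀ {S p} → All (OnBoard n) S → OnBoard n p → SeenBy S p → SeenBy (map σ S) (σ p)
  seen-image (q-on ∷ _) p-on (here s)  = here (preserves q-on p-on s)
  seen-image (_ ∷ S-on) p-on (there s) = there (seen-image S-on p-on s)
  covers : ∀ {p} → OnBoard n p → SeenBy S p → p ∈ map σ (seenSquares n (map σ S))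
  covers p-on seen =
    subst (_∈ map σ (seenSquares n (map σ S))) (involutive p-on)
      (∈-map⁺ σ (∈-seenSquares (onBoard p-on) (seen-image S-on p-on seen)))

swap-symmetry : ∀ n → Symmetry n swap
swap-symmetry n = record
  { onBoard    = swap
  ; involutive = λ _ → refl
  ; preserves  = λ { {i , j} {u , v} _ _ → λ where
      (inj₁ i≡u)               → inj₂ (inj₁ i≡u)
      (inj₂ (inj₁ j≡v))        → inj₁ j≡v
      (inj₂ (inj₂ (inj₁ dia))) → inj₂ (inj₂ (inj₁ (trans (+-comm j u) (trans (sym dia) (+-comm i v)))))
      (inj₂ (inj₂ (inj₂ ant))) → inj₂ (inj₂ (inj₂ (trans (+-comm j i) (trans ant (+-comm u v))))) }
  }

reflect : ℕ → Square → Square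
reflect n (i , j) = n ∸ suc i , j

reflected-sum : ∀ {n i} → i < n → (n ∸ suc i) + suc i ≡ n
reflected-sum i<n = m∸n+n≡m i<n

reflected-+ : ∀ {n i u} x y → i < n → u < n → x + u ≡ y + i → (n ∸ suc i) + x ≡ (n ∸ suc u) + y
reflected-+ {n} {i} {u} x y i<n u<n eq = +-cancelʳ-≡ (suc (i + u)) _ _ (begin
  (a + x) + suc (i + u)     ≡⟨ rearrange a x i u ⟩
  (a + suc i) + (x + u)     ≡⟨ cong₂ _+_ (trans (reflected-sum i<n) (sym (reflected-sum u<n))) eq ⟩
  (b + suc u) + (y + i)     ≡⟨ rearrange′ b y i u ⟩
  (b + y) + suc (i + u)     ∎)
  where
  open ≡-Reasoning
  a = n ∸ suc i
  b = n ∸ suc u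
  rearrange : ∀ a x i u → (a + x) + suc (i + u) ≡ (a + suc i) + (x + u)
  rearrange = solve-∀
  rearrange′ : ∀ b y i u → (b + suc u) + (y + i) ≡ (b + y) + suc (i + u)
  rearrange′ = solve-∀

reflect-symmetry : ∀ n → Symmetry n (reflect n)
reflect-symmetry n = record
  { onBoard    = λ { (i< , j<) → ∸-monoʳ-< z<s i< , j< }
  ; involutive = λ { (i< , j<) → cong (_, _) (reflect² i<) }
  ; preserves  = λ { {i , j} {u , v} (i< , _) (u< , _) → λ where
      (inj₁ i≡u)               → inj₁ (cong (λ x → n ∸ suc x) i≡u)
      (inj₂ (inj₁ j≡v))        → inj₂ (inj₁ j≡v)
      -- A reflection exchanges the two directions of diagonals.
      (inj₂ (inj₂ (inj₁ dia))) → inj₂ (inj₂ (inj₂ (reflected-+ j v i< u<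
        (trans (+-comm j u) (trans (sym dia) (+-comm i v))))))
      (inj₂ (inj₂ (inj₂ ant))) → inj₂ (inj₂ (inj₁ (reflected-+ v j i< u<
        (trans (+-comm v u) (trans (sym ant) (+-comm i j)))))) }
  }
  where
  reflect² : ∀ {i} → i < n → n ∸ suc (n ∸ suc i) ≡ i
  reflect² {i} i<n = +-cancelʳ-≡ (suc (n ∸ suc i)) _ _ (begin
    n ∸ suc (n ∸ suc i) + suc (n ∸ suc i) ≡⟨ reflected-sum (∸-monoʳ-< z<s i<n) ⟩
    n                                     ≡⟨ reflected-sum i<n ⟨
    (n ∸ suc i) + suc i                   ≡⟨ +-suc (n ∸ suc i) i ⟩
    suc (n ∸ suc i + i)                   ≡⟨ cong suc (+-comm (n ∸ suc i) i) ⟩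
    suc (i + (n ∸ suc i))                 ≡⟨ +-suc i (n ∸ suc i) ⟨
    i + suc (n ∸ suc i)                   ∎)
    where open ≡-Reasoning

-- Concentric boxes and queens on their edges

Inner : ℕ → ℕ → ℕ → Set
Inner s n i = s ≤ i × i + s < n

Box : ℕ → ℕ → Square → Set
Box s n (i , j) = Inner s n i × Inner s n j

Extreme : ℕ → ℕ → ℕ → Set
Extreme s n i = i ≡ s ⊎ suc (i + s) ≡ n

OnEdge : ℕ → ℕ → Square → Set
OnEdge s n (i , j) = Extreme s n i ⊎ Extreme s n j

Box⇒OnBoard : ∀ {s n p} → Box s n p → OnBoard n p
Box⇒OnBoard ((_ , i<) , (_ , j<)) = ≤-<-trans (m≤m+n _ _) i< , ≤-<-trans (m≤m+n _ _) j<

OnBoard⇒Box : ∀ {n p} → OnBoard n p → Box 0 n p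
OnBoard⇒Box (i< , j<) =
  (z≤n , subst (_< _) (sym (+-identityʳ _)) i<) , (z≤n , subst (_< _) (sym (+-identityʳ _)) j<)

shrink : ∀ {s n i} → Inner s n i → Extreme s n i ⊎ Inner (suc s) n i
shrink {s} {n} {i} (s≤i , i+s<n) with s ≟ i | suc (i + s) ≟ n
... | yes s≡i | _      = inj₁ (inj₁ (sym s≡i))
... | no _    | yes eq = inj₁ (inj₂ eq)
... | no s≢i  | no neq = inj₂ (≤∧≢⇒< s≤i s≢i , subst (_< n) (sym (+-suc i s)) (≤∧≢⇒< i+s<n neq))

edge-or-inside : ∀ {s n} S → All (Box s n) S → (∃[ q ] q ∈ S × OnEdge s n q) ⊎ All (Box (suc s) n) S
edge-or-inside []      []         = inj₂ []
edge-or-inside (q ∷ S) ((i-in , j-in) ∷ S-in) with shrink i-in | shrink j-in | edge-or-inside S S-in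
... | inj₁ edge | _         | _                      = inj₁ (q , here refl , inj₁ edge)
... | inj₂ _    | inj₁ edge | _                      = inj₁ (q , here refl , inj₂ edge)
... | inj₂ _    | inj₂ _    | inj₁ (q′ , q′∈ , edge) = inj₁ (q′ , there q′∈ , edge)
... | inj₂ i-in | inj₂ j-in | inj₂ inside            = inj₂ ((i-in , j-in) ∷ inside)

Inner-reflect : ∀ {s n i} → Inner s n i → Inner s n (n ∸ suc i)
Inner-reflect {s} {n} {i} (s≤i , i+s<n) =
  m+n≤o⇒m≤o∸n s (≤-trans (≤-reflexive (+-comm s (suc i))) i+s<n) ,
  <-≤-trans (+-monoʳ-< (n ∸ suc i) (s≤s s≤i))
            (≤-reflexive (reflected-sum (≤-<-trans (m≤m+n i s) i+s<n)))

-- A queen on the edge of a box may be assumed to lie in the left half of its bottom row.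
module _ {s n k c t : ℕ}
  (bottom : ∀ S → length S ≡ k → All (Box s n) S → ∀ i → (i , s) ∈ S → i + i < n → seenNumber n S + c ≤ t)
  where

  private
    Claim : (Square → Set) → Set
    Claim P = ∀ S → length S ≡ k → All (Box s n) S → ∀ q → q ∈ S → P q → seenNumber n S + c ≤ t

    by-symmetry : ∀ {σ P Q} → Symmetry n σ → (∀ {q} → Box s n q → Box s n (σ q)) →
                  (∀ {q} → Box s n q → Q q → P (σ q)) → Claim P → Claim Q
    by-symmetry {σ} sym-σ box Q⇒P claim S len S-in q q∈ Qq =
      ≤-trans (+-monoˡ-≤ c (seenNumber-symmetry sym-σ (All.map Box⇒OnBoard S-in)))
        (claim (map σ S) (trans (length-map σ S) len) (All.map⁺ (All.map box S-in))
          (σ q) (∈-map⁺ σ q∈) (Q⇒P (All.lookup S-in q∈) Qq))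

    by-swap : ∀ {P} → Claim P → Claim (P ∘ swap)
    by-swap = by-symmetry (swap-symmetry n) swap (λ _ P → P)

    box-reflect : ∀ {q} → Box s n q → Box s n (reflect n q)
    box-reflect (i-in , j-in) = Inner-reflect i-in , j-in

    bottom-left : Claim (λ (i , j) → j ≡ s × i + i < n)
    bottom-left S len S-in (i , j) q∈ (refl , 2i<n) = bottom S len S-in i q∈ 2i<n

    bottom-right : Claim (λ (i , j) → j ≡ s × n ≤ i + i)
    bottom-right = by-symmetry (reflect-symmetry n) box-reflect
      (λ { {i , j} (i-in , _) (j≡s , n≤2i) → j≡s , to-left i (Box⇒OnBoard (i-in , i-in) .proj₁) n≤2i }) bottom-left
      where
      to-left : ∀ i → i < n → n ≤ i + i → (n ∸ suc i) + (n ∸ suc i) < n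
      to-left i i<n n≤2i = subst (r + r <_) (reflected-sum i<n) (+-monoʳ-< r (s≤s (<⇒≤ r<i)))
        where
        r = n ∸ suc i
        r<i : suc r ≤ i
        r<i = +-cancelʳ-≤ i (suc r) i (subst (_≤ i + i) (sym (trans (sym (+-suc r i)) (reflected-sum i<n))) n≤2i)

    bottom-row : Claim (λ (i , j) → j ≡ s)
    bottom-row S len S-in (i , j) q∈ j≡s with i + i <? n
    ... | yes 2i<n = bottom-left  S len S-in (i , j) q∈ (j≡s , 2i<n)
    ... | no ¬2i<n = bottom-right S len S-in (i , j) q∈ (j≡s , ≮⇒≥ ¬2i<n)

    left-column : Claim (λ (i , j) → i ≡ s)
    left-column = by-swap bottom-row

    right-column : Claim (λ (i , j) → suc (i + s) ≡ n)
    right-column = by-symmetry (reflect-symmetry n) box-reflect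
      (λ { {i , j} _ refl → m+n∸m≡n i s }) left-column

    top-row : Claim (λ (i , j) → suc (j + s) ≡ n)
    top-row = by-swap right-column

  edge-bound : ∀ S → length S ≡ k → All (Box s n) S → ∀ q → q ∈ S → OnEdge s n q → seenNumber n S + c ≤ t
  edge-bound S len S-in q q∈ (inj₁ (inj₁ eq)) = left-column  S len S-in q q∈ eq
  edge-bound S len S-in q q∈ (inj₁ (inj₂ eq)) = right-column S len S-in q q∈ eq
  edge-bound S len S-in q q∈ (inj₂ (inj₁ eq)) = bottom-row   S len S-in q q∈ eq
  edge-bound S len S-in q q∈ (inj₂ (inj₂ eq)) = top-row      S len S-in q q∈ eq

-- Enlarging the board

-- The squares where the four lines of a queen leave a board with last index m;
-- the truncated subtractions pick the side on which a diagonal ends.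
ends : ℕ → Square → List Square
ends m (i , j) =
  (i , 0) ∷ (i , m) ∷ (0 , j) ∷ (m , j) ∷
  (i ∸ j , j ∸ i) ∷ (m ∸ (j ∸ i) , m ∸ (i ∸ j)) ∷
  ((i + j) ∸ m , (i + j) ⊓ m) ∷ ((i + j) ⊓ m , (i + j) ∸ m) ∷ []

private
  at-5 : ∀ {X : Set} {a b c d e x : X} {xs} → x ≡ e → x ∈ a ∷ b ∷ c ∷ d ∷ e ∷ xs
  at-5 eq = there (there (there (there (here eq))))

  at-6 : ∀ {X : Set} {a b c d e f x : X} {xs} → x ≡ f → x ∈ a ∷ b ∷ c ∷ d ∷ e ∷ f ∷ xs
  at-6 eq = there (at-5 eq)

  at-7 : ∀ {X : Set} {a b c d e f g x : X} {xs} → x ≡ g → x ∈ a ∷ b ∷ c ∷ d ∷ e ∷ f ∷ g ∷ xs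
  at-7 eq = there (at-6 eq)

  at-8 : ∀ {X : Set} {a b c d e f g h x : X} {xs} → x ≡ h → x ∈ a ∷ b ∷ c ∷ d ∷ e ∷ f ∷ g ∷ h ∷ xs
  at-8 eq = there (at-7 eq)

OnRing : ℕ → Square → Set
OnRing m (u , v) = (u ≡ 0 ⊎ v ≡ 0) ⊎ (u ≡ m ⊎ v ≡ m)

-- The row or column of a queen on the ring could lie within the ring entirely; `Box 1` excludes
-- this, in the contradictory cases. Every other line meets the ring only at its two ends.
seen-on-ring : ∀ {m} q {p} → Box 1 (suc m) q → OnBoard (suc m) p → OnRing m p → Sees q p → p ∈ ends m q
seen-on-ring _ (((1≤i , _) , _)) _ (inj₁ (inj₁ refl)) (inj₁ refl) = contradiction 1≤i λ ()
seen-on-ring _ _ _ (inj₁ (inj₂ refl)) (inj₁ refl) = here refl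
seen-on-ring {m} _ ((_ , i<) , _) _ (inj₂ (inj₁ refl)) (inj₁ refl) =
  contradiction (subst (_< suc m) (+-comm m 1) i<) (<-irrefl refl)
seen-on-ring _ _ _ (inj₂ (inj₂ refl)) (inj₁ refl) = there (here refl)
seen-on-ring _ _ _ (inj₁ (inj₁ refl)) (inj₂ (inj₁ refl)) = there (there (here refl))
seen-on-ring _ (_ , (1≤j , _)) _ (inj₁ (inj₂ refl)) (inj₂ (inj₁ refl)) = contradiction 1≤j λ ()
seen-on-ring _ _ _ (inj₂ (inj₁ refl)) (inj₂ (inj₁ refl)) = there (there (there (here refl)))
seen-on-ring {m} _ (_ , (_ , j<)) _ (inj₂ (inj₂ refl)) (inj₂ (inj₁ refl)) =
  contradiction (subst (_< suc m) (+-comm m 1) j<) (<-irrefl refl)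
seen-on-ring (i , _) {_ , v} _ _ (inj₁ (inj₁ refl)) (inj₂ (inj₂ (inj₁ refl))) =
  at-5 (cong₂ _,_ (sym (m≤n⇒m∸n≡0 (m≤m+n i v))) (sym (m+n∸m≡n i v)))
seen-on-ring (i , j) {u , _} _ _ (inj₁ (inj₂ refl)) (inj₂ (inj₂ (inj₁ eq)))
  rewrite trans (sym (+-identityʳ i)) eq =
  at-5 (cong₂ _,_ (sym (m+n∸n≡m u j)) (sym (m≤n⇒m∸n≡0 (m≤n+m j u))))
seen-on-ring {m} (i , j) {_ , v} _ (_ , s≤s v≤m) (inj₂ (inj₁ refl)) (inj₂ (inj₂ (inj₁ eq))) =
  at-6 (cong₂ _,_
    (sym (trans (cong (m ∸_) (trans (cong (j ∸_) i≡) (m≤n⇒m∸n≡0 (m≤n+m j (m ∸ v))))) refl))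
    (sym (trans (cong (m ∸_) (trans (cong (_∸ j) i≡) (m+n∸n≡m (m ∸ v) j))) (m∸[m∸n]≡n v≤m))))
  where
  i≡ : i ≡ (m ∸ v) + j
  i≡ = +-cancelʳ-≡ v _ _ (trans eq (trans (cong (_+ j) (sym (m∸n+n≡m v≤m))) (+-+-comm (m ∸ v) v j)))
    where +-+-comm : ∀ x y z → x + y + z ≡ x + z + y
          +-+-comm = solve-∀
seen-on-ring {m} (i , j) {u , _} _ (s≤s u≤m , _) (inj₂ (inj₂ refl)) (inj₂ (inj₂ (inj₁ eq))) =
  at-6 (cong₂ _,_
    (sym (trans (cong (m ∸_) (trans (cong (_∸ i) j≡) (m+n∸n≡m (m ∸ u) i))) (m∸[m∸n]≡n u≤m)))
    (sym (trans (cong (m ∸_) (trans (cong (i ∸_) j≡) (m≤n⇒m∸n≡0 (m≤n+m i (m ∸ u))))) refl)))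
  where
  j≡ : j ≡ (m ∸ u) + i
  j≡ = +-cancelˡ-≡ u _ _ (trans (sym eq) (trans (cong (i +_) (sym (m∸n+n≡m u≤m))) (rotate i (m ∸ u) u)))
    where rotate : ∀ x y z → x + (y + z) ≡ z + (y + x)
          rotate = solve-∀
seen-on-ring {m} (i , j) {_ , v} _ (_ , s≤s v≤m) (inj₁ (inj₁ refl)) (inj₂ (inj₂ (inj₂ refl))) =
  at-7 (cong₂ _,_ (sym (m≤n⇒m∸n≡0 v≤m)) (sym (m≤n⇒m⊓n≡m v≤m)))
seen-on-ring {m} (i , j) {u , _} _ (s≤s u≤m , _) (inj₁ (inj₂ refl)) (inj₂ (inj₂ (inj₂ eq)))
  rewrite trans eq (+-identityʳ u) =
  at-8 (cong₂ _,_ (sym (m≤n⇒m⊓n≡m u≤m)) (sym (m≤n⇒m∸n≡0 u≤m)))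
seen-on-ring {m} (i , j) {_ , v} _ _ (inj₂ (inj₁ refl)) (inj₂ (inj₂ (inj₂ eq)))
  rewrite eq = at-8 (cong₂ _,_ (sym (m≥n⇒m⊓n≡n (m≤m+n m v))) (sym (m+n∸m≡n m v)))
seen-on-ring {m} (i , j) {u , _} _ _ (inj₂ (inj₂ refl)) (inj₂ (inj₂ (inj₂ eq)))
  rewrite eq = at-7 (cong₂ _,_ (sym (m+n∸n≡m u m)) (sym (m≥n⇒m⊓n≡n (m≤n+m m u))))

up down : Square → Square
up   (i , j) = suc i , suc j
down (i , j) = pred i , pred j

Sees-up⁻ : ∀ {q p} → Sees (up q) (up p) → Sees q p
Sees-up⁻ (inj₁ eq) = inj₁ (suc-injective eq)
Sees-up⁻ (inj₂ (inj₁ eq)) = inj₂ (inj₁ (suc-injective eq))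
Sees-up⁻ {i , j} {u , v} (inj₂ (inj₂ (inj₁ eq))) =
  inj₂ (inj₂ (inj₁ (suc-injective (trans (sym (+-suc i v)) (trans (suc-injective eq) (+-suc u j))))))
Sees-up⁻ {i , j} {u , v} (inj₂ (inj₂ (inj₂ eq))) =
  inj₂ (inj₂ (inj₂ (suc-injective (trans (sym (+-suc i j)) (trans (suc-injective eq) (+-suc u v))))))

ring-or-inside : ∀ {n p} → OnBoard (2 + n) p → OnRing (suc n) p ⊎ ∃[ p′ ] p ≡ up p′ × OnBoard n p′
ring-or-inside {n} {zero , v} _ = inj₁ (inj₁ (inj₁ refl))
ring-or-inside {n} {suc u , zero} _ = inj₁ (inj₁ (inj₂ refl))
ring-or-inside {n} {suc u , suc v} (s≤s (s≤s u≤) , s≤s (s≤s v≤)) with m≤n⇒m<n∨m≡n u≤ | m≤n⇒m<n∨m≡n v≤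
... | inj₂ refl | _         = inj₁ (inj₂ (inj₁ refl))
... | inj₁ _    | inj₂ refl = inj₁ (inj₂ (inj₂ refl))
... | inj₁ u<   | inj₁ v<   = inj₂ ((u , v) , refl , u< , v<)

Box-down : ∀ {n q} → Box 1 (2 + n) q → up (down q) ≡ q × OnBoard n (down q)
Box-down {n} {suc i , suc j} ((_ , s≤s i<) , (_ , s≤s j<)) =
  refl , s≤s⁻¹ (subst (_< suc n) (+-comm i 1) i<) , s≤s⁻¹ (subst (_< suc n) (+-comm j 1) j<)

length-concatMap : ∀ {X Y : Set} (f : X → List Y) {l} → (∀ x → length (f x) ≡ l) →
                   ∀ xs → length (concatMap f xs) ≡ length xs * l
length-concatMap f eq []       = refl
length-concatMap f eq (x ∷ xs) = trans (length-++ (f x)) (cong₂ _+_ (eq x) (length-concatMap f eq xs))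

seenNumber-grow : ∀ n S → All (Box 1 (2 + n)) S → seenNumber (2 + n) S ≤ seenNumber n (map down S) + length S * 8
seenNumber-grow n S S-in = ≤-trans (seenNumber≤length (2 + n) S squares covers) (≤-reflexive
  (trans (length-++ (map up (seenSquares n (map down S))))
         (cong₂ _+_ (length-map up (seenSquares n (map down S)))
                    (length-concatMap (ends (suc n)) (λ _ → refl) S))))
  where
  squares = map up (seenSquares n (map down S)) ++ concatMap (ends (suc n)) S

  seen-inside : ∀ {S p} → All (Box 1 (2 + n)) S → SeenBy S (up p) → SeenBy (map down S) p
  seen-inside (q-in ∷ _) (here s) =
    here (Sees-up⁻ (subst (λ q → Sees q _) (sym (proj₁ (Box-down q-in))) s))
  seen-inside (_ ∷ S-in) (there s) = there (seen-inside S-in s)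

  seen-outside : ∀ {S p} → All (Box 1 (2 + n)) S → OnBoard (2 + n) p → OnRing (suc n) p → SeenBy S p →
                 p ∈ concatMap (ends (suc n)) S
  seen-outside {q ∷ S} (q-in ∷ _) p-on ring (here s)  = ∈-++⁺ˡ (seen-on-ring q q-in p-on ring s)
  seen-outside {q ∷ S} (_ ∷ S-in) p-on ring (there s) = ∈-++⁺ʳ (ends (suc n) q) (seen-outside S-in p-on ring s)

  covers : ∀ {p} → OnBoard (2 + n) p → SeenBy S p → p ∈ squares
  covers p-on seen with ring-or-inside p-on
  ... | inj₁ ring = ∈-++⁺ʳ (map up (seenSquares n (map down S))) (seen-outside S-in p-on ring seen)
  ... | inj₂ (p′ , refl , p′-on) = ∈-++⁺ˡ (∈-map⁺ up (∈-seenSquares p′-on (seen-inside S-in seen)))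

-- In column u, the diagonals of the queen meet the board at height ∣ u - i ∣ only.
seenNumber-bottom : ∀ n i S₁ S₂ → seenNumber n (S₁ ++ (i , 0) ∷ S₂) ≤ seenNumber n (S₁ ++ S₂) + 3 * n
seenNumber-bottom n i S₁ S₂ = ≤-trans (seenNumber≤length n (S₁ ++ (i , 0) ∷ S₂) squares covers) (≤-reflexive
  (trans (length-++ rest) (cong (length rest +_) len)))
  where
  rest = seenSquares n (S₁ ++ S₂)
  f g h : ℕ → Square
  f u = u , 0
  g u = i , u
  h u = u , ∣ u - i ∣
  new = map f (upTo n) ++ map g (upTo n) ++ map h (upTo n)
  squares = rest ++ new

  length-row : (f : ℕ → Square) → length (map f (upTo n)) ≡ n
  length-row f = trans (length-map f (upTo n)) (length-upTo n)

  len : length new ≡ 3 * n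
  len = trans (length-++ (map f (upTo n))) (cong₂ _+_ (length-row f)
          (trans (length-++ (map g (upTo n))) (cong₂ _+_ (length-row g)
            (trans (length-row h) (sym (+-identityʳ n))))))

  new-seen : ∀ {p} → OnBoard n p → Sees (i , 0) p → p ∈ new
  new-seen (_ , v<) (inj₁ refl) = ∈-++⁺ʳ (map f (upTo n)) (∈-++⁺ˡ (∈-map⁺ g (∈-upTo⁺ v<)))
  new-seen (u< , _) (inj₂ (inj₁ refl)) = ∈-++⁺ˡ (∈-map⁺ f (∈-upTo⁺ u<))
  new-seen {u , v} (u< , _) (inj₂ (inj₂ (inj₁ eq))) =
    ∈-++⁺ʳ (map f (upTo n)) (∈-++⁺ʳ (map g (upTo n)) (subst (λ w → (u , w) ∈ _) distance (∈-map⁺ h (∈-upTo⁺ u<))))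
    where
    distance : ∣ u - i ∣ ≡ v
    distance = trans (∣-∣-comm u i) (trans (cong (∣ i -_∣) (trans (sym (+-identityʳ u)) (sym eq))) (∣m-m+n∣≡n i v))
  new-seen {u , v} (u< , _) (inj₂ (inj₂ (inj₂ eq))) =
    ∈-++⁺ʳ (map f (upTo n)) (∈-++⁺ʳ (map g (upTo n)) (subst (λ w → (u , w) ∈ _) distance (∈-map⁺ h (∈-upTo⁺ u<))))
    where
    distance : ∣ u - i ∣ ≡ v
    distance = trans (cong (∣ u -_∣) (trans (sym (+-identityʳ i)) eq)) (∣m-m+n∣≡n u v)

  middle : ∀ {P : Square → Set} xs {q ys} → Any P (xs ++ q ∷ ys) → P q ⊎ Any P (xs ++ ys)
  middle []       (here Pq)  = inj₁ Pq
  middle []       (there p)  = inj₂ p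
  middle (x ∷ xs) (here Px)  = inj₂ (here Px)
  middle (x ∷ xs) (there p) with middle xs p
  ... | inj₁ Pq = inj₁ Pq
  ... | inj₂ p′ = inj₂ (there p′)

  covers : ∀ {p} → OnBoard n p → SeenBy (S₁ ++ (i , 0) ∷ S₂) p → p ∈ squares
  covers p-on seen with middle S₁ seen
  ... | inj₁ s     = ∈-++⁺ʳ rest (new-seen p-on s)
  ... | inj₂ seen′ = ∈-++⁺ˡ (∈-seenSquares p-on seen′)

-- Coding squares for the search

label : ℕ → ℕ
label k = radix ^ k ∸ 1

IsLabel-label : ∀ k → IsLabel (label k)
IsLabel-label k = k , suc-power radix k
  where
  suc-power : ∀ β k .{{_ : NonZero β}} → suc (β ^ k ∸ 1) ≡ β ^ k
  suc-power β k = m+[n∸m]≡n (m^n>0 β k)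

-- The index `i - j` of a diagonal is shifted by `n` to be nonnegative; on the board `n ∸ j` is not
-- truncated.
code : ℕ → Square → Cell
code n (i , j) = cell (label i) (label j) (label (i + (n ∸ j))) (label (i + j))

IsCell-code : ∀ n p → IsCell (code n p)
IsCell-code n (i , j) = IsLabel-label i , IsLabel-label j , IsLabel-label (i + (n ∸ j)) , IsLabel-label (i + j)

T-∨₄ : ∀ x y z w → T x ⊎ T y ⊎ T z ⊎ T w → T (x ∨ y ∨ z ∨ w)
T-∨₄ true  _     _     _    _                      = _
T-∨₄ false true  _     _    _                      = _
T-∨₄ false false true  _    _                      = _
T-∨₄ false false false true _                      = _
T-∨₄ false false false false (inj₂ (inj₂ (inj₁ ())))
T-∨₄ false false false false (inj₂ (inj₂ (inj₂ ())))

code-sees : ∀ {n q p} → OnBoard n q → OnBoard n p → Sees q p → T (sees (code n q) (code n p))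
code-sees {n} {i , j} {u , v} (_ , j<) (_ , v<) seen = T-∨₄ (label i ≡ᵇ label u) (label j ≡ᵇ label v)
  (label (i + (n ∸ j)) ≡ᵇ label (u + (n ∸ v))) (label (i + j) ≡ᵇ label (u + v)) (cases seen)
  where
  labels : ∀ k l → k ≡ l → T (label k ≡ᵇ label l)
  labels k l eq = ≡⇒≡ᵇ (label k) (label l) (cong label eq)
  rearrange : ∀ i x j v → i + x + (j + v) ≡ (x + j) + (i + v)
  rearrange = solve-∀
  rearrange′ : ∀ u x j v → (x + v) + (u + j) ≡ u + x + (j + v)
  rearrange′ = solve-∀
  cases : Sees (i , j) (u , v) → _
  cases (inj₁ eq)               = inj₁ (labels i u eq)
  cases (inj₂ (inj₁ eq))        = inj₂ (inj₁ (labels j v eq))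
  cases (inj₂ (inj₂ (inj₂ eq))) = inj₂ (inj₂ (inj₂ (labels (i + j) (u + v) eq)))
  cases (inj₂ (inj₂ (inj₁ eq))) = inj₂ (inj₂ (inj₁ (labels (i + (n ∸ j)) (u + (n ∸ v)) (+-cancelʳ-≡ (j + v) _ _ (begin
    i + (n ∸ j) + (j + v)   ≡⟨ rearrange i (n ∸ j) j v ⟩
    (n ∸ j + j) + (i + v)   ≡⟨ cong₂ _+_ (trans (m∸n+n≡m (<⇒≤ j<)) (sym (m∸n+n≡m (<⇒≤ v<)))) eq ⟩
    (n ∸ v + v) + (u + j)   ≡⟨ rearrange′ u (n ∸ v) j v ⟩
    u + (n ∸ v) + (j + v)   ∎)))))
    where open ≡-Reasoning

-- The upper bound

inner? : ∀ s n → Decidable (Inner s n)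
inner? s n i = s ≤? i ×-dec i + s <? n

inner : ℕ → ℕ → List ℕ
inner s n = filter (inner? s n) (upTo n)

∈-inner : ∀ {s n i} → Inner s n i → i ∈ inner s n
∈-inner {s} {n} {i} i-in = ∈-filter⁺ (inner? s n) (∈-upTo⁺ (≤-<-trans (m≤m+n i s) (proj₂ i-in))) i-in

candidate : ℕ → Square → Candidate
candidate n p = true , code n p

candidates : ℕ → ℕ → List Candidate
candidates s n = map (candidate n) (cartesianProduct (inner s n) (inner s n))

searchWith : ℕ → ℕ → List Cell → List Candidate → Cell → Bool
searchWith m k U cs q = search m k (unseen q U) (map (mark q) cs)

-- On boards with at least 11 rows, k ≤ 4 queens see at most 4 * k * n ∸ loss k
-- squares; the constants were found by exhaustive search on small boards.
loss : ℕ → ℕ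
loss 0 = 0
loss 1 = 3
loss 2 = 20
loss 3 = 43
loss _ = 72

module _ (k s n : ℕ) where

  searchAll : ℕ → List Cell → List Candidate → Bool
  searchAll m U cs = all (λ i → (n ≤ᵇ i + i) ∨ searchWith m k U cs (code n (i , s))) (inner s n)

  -- To see at most `4 * suc k * n` minus the loss is to leave at least
  -- `n * n + loss (suc k) ∸ 4 * suc k * n` squares unseen. The first test ensures that this
  -- subtraction is not truncated, the second that line counts fit into one digit; the largest board
  -- checked has 28 rows and 784 squares.
  check : Bool
  check =
    (4 * suc k * n ≤ᵇ n * n + loss (suc k)) ∧ (n * n <ᵇ radix) ∧
    searchAll (n * n + loss (suc k) ∸ 4 * suc k * n) (map (code n) (grid n)) (candidates s n)

Bounded : ℕ → ℕ → Set
Bounded k n = ∀ S → length S ≡ k → All (OnBoard n) S → seenNumber n S + loss k ≤ 4 * k * n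

BottomBounded : ℕ → ℕ → ℕ → Set
BottomBounded k s n = ∀ S → length S ≡ k → All (Box s n) S → ∀ i → (i , s) ∈ S → i + i < n →
                      seenNumber n S + loss k ≤ 4 * k * n

candidates-valid : ∀ s n → n * n < radix → Valid (map (code n) (grid n)) (candidates s n)
candidates-valid s n small = record
  { small   = subst (_< radix) (sym (trans (length-map (code n) (grid n)) (length-grid n))) small
  ; cells   = All.map⁺ (All.universal (IsCell-code n) (grid n))
  ; cells′  = All.map⁺ (All.universal (IsCell-code n) (cartesianProduct (inner s n) (inner s n)))
  ; unseen! = All.map⁺ (All.tabulate (λ p∈ _ → ∈-map⁺ (code n) (∈-grid⁺ (on-board p∈))))
  }
  where
  on-board : ∀ {p} → p ∈ cartesianProduct (inner s n) (inner s n) → OnBoard n p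
  on-board p∈ with ∈-cartesianProduct⁻ (inner s n) (inner s n) p∈
  ... | i∈ , j∈ = ∈-upTo⁻ (proj₁ (∈-filter⁻ (inner? s n) i∈)) , ∈-upTo⁻ (proj₁ (∈-filter⁻ (inner? s n) {xs = upTo n} j∈))

among-candidates : ∀ s n {S} → All (Box s n) S → AmongCandidates (candidates s n) (map (code n) S)
among-candidates s n = All.map⁺ ∘ All.map λ { (i-in , j-in) →
  Any.map⁺ (Any.map (λ eq → cong (code n) (sym eq)) (∈-cartesianProduct⁺ (∈-inner i-in) (∈-inner j-in))) }

check-sound : ∀ k s n → T (check k s n) → BottomBounded (suc k) s n
check-sound k s n checked S len S-in i q∈ 2i<n
  with ∈-∃++ q∈ | Equivalence.to (T-∧ {4 * suc k * n ≤ᵇ n * n + loss (suc k)}) checked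
... | S₁ , S₂ , refl | enough , checked′ with Equivalence.to (T-∧ {n * n <ᵇ radix}) checked′
... | small , found = +-cancelʳ-≤ (n * n) _ _ (begin
  seen + c + n * n                           ≡⟨ +-assoc seen c (n * n) ⟩
  seen + (c + n * n)                         ≡⟨ cong (seen +_) (+-comm c (n * n)) ⟩
  seen + (n * n + c)                         ≡⟨ cong (seen +_) (m∸n+n≡m {n * n + c} {t} (≤ᵇ⇒≤ t (n * n + c) enough)) ⟨
  seen + (m + t)                             ≡⟨ +-assoc seen m t ⟨
  seen + m + t                               ≤⟨ +-monoˡ-≤ t (+-monoʳ-≤ seen left) ⟩
  seen + length (unseenBy (map (code n) S) U) + t ≤⟨ +-monoˡ-≤ t total ⟩
  n * n + t                                  ≡⟨ +-comm (n * n) t ⟩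
  t + n * n                                  ∎)
  where
  open ≤-Reasoning
  c    = loss (suc k)
  t    = 4 * suc k * n
  m    = n * n + c ∸ t
  U    = map (code n) (grid n)
  q    = code n (i , s)
  seen = seenNumber n S

  total : seen + length (unseenBy (map (code n) S) U) ≤ n * n
  total = subst (seen + length (unseenBy (map (code n) S) U) ≤_) (length-grid n)
    (length-seenBy+unseenBy S (code n) (grid n)
      (All.tabulate (λ p∈ → All.map (λ q-in → code-sees (Box⇒OnBoard q-in) (∈-grid⁻ p∈)) S-in)))

  searched : T (searchWith m k U (candidates s n) q)
  searched with Equivalence.to (T-∨ {n ≤ᵇ i + i}) (All.lookup (All.all⁺ _ (inner s n) found) (∈-inner (proj₁ (All.lookup S-in q∈))))
  ... | inj₁ n≤2i = contradiction (≤ᵇ⇒≤ n (i + i) n≤2i) (<⇒≱ 2i<n)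
  ... | inj₂ done = done

  left : m ≤ length (unseenBy (map (code n) S) U)
  left = subst (λ C → m ≤ length (unseenBy C U)) (sym (map-++ (code n) S₁ ((i , s) ∷ S₂)))
    (branch q (map (code n) S₁) (search-sound k m) (candidates-valid s n (<ᵇ⇒< _ _ small)) searched
      (trans (cong length (sym (map-++ (code n) S₁ ((i , s) ∷ S₂)))) (trans (length-map (code n) S) len))
      (subst (AmongCandidates (candidates s n)) (map-++ (code n) S₁ ((i , s) ∷ S₂)) (among-candidates s n S-in)))

Box-empty : ∀ {s n p} → n ≤ s + s → ¬ Box s n p
Box-empty {s} n≤2s ((s≤i , i+s<n) , _) = <⇒≱ i+s<n (≤-trans n≤2s (+-monoˡ-≤ s s≤i))

-- The smallest concentric box containing all the queens has one of them on its edge. Peeling off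
-- layers finds it before layer `t`, where the box is empty.
boxes-bounded : ∀ k n t → n ≤ t + t → (∀ {s} → s < t → BottomBounded (suc k) s n) → Bounded (suc k) n
boxes-bounded k n t n≤2t bottom S len S-on = go t 0 refl S len (All.map OnBoard⇒Box S-on)
  where
  go : ∀ d s → s + d ≡ t → ∀ S → length S ≡ suc k → All (Box s n) S →
       seenNumber n S + loss (suc k) ≤ 4 * suc k * n
  go zero    s s+d≡t (q ∷ _) _ (q-in ∷ _) =
    contradiction q-in (Box-empty (subst (λ x → n ≤ x + x) (trans (sym s+d≡t) (+-identityʳ s)) n≤2t))
  go (suc d) s s+d≡t S len S-in with edge-or-inside S S-in
  ... | inj₁ (q , q∈ , edge) =
    edge-bound (bottom (subst (s <_) s+d≡t (m<m+n s z<s))) S len S-in q q∈ edge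
  ... | inj₂ inside = go d (suc s) (trans (sym (+-suc s d)) s+d≡t) S len inside

-- On boards of at least this size, seenNumber-bottom and the bound for k queens
-- give the bound for suc k queens one of which is on the edge.
threshold : ℕ → ℕ
threshold k = loss (suc k) ∸ loss k

-- Six layers exhaust a board of 11 or 12 rows. The medium boards start at 13 rows and end just
-- below `threshold k`: there are none for one queen, and they end at 16, 22 and 28 rows for two,
-- three and four queens.
smallBoards mediumBoards : ℕ → Bool
smallBoards  k = all (λ s → check k s 11 ∧ check k s 12) (upTo 6)
mediumBoards k = all (check k 0) (applyUpTo (13 +_) (threshold k ∸ 13))

m∸n≤o⇒m≤n+o : ∀ m n {o} → m ∸ n ≤ o → m ≤ n + o
m∸n≤o⇒m≤n+o m n m∸n≤o = ≤-trans (m≤n+m∸n m n) (+-monoʳ-≤ n m∸n≤o)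

-- The queen on the edge uses at most `3 * n` of its budget `4 * n`; the remaining `n` pays for the
-- increase of `loss`.
bottom-bounded : ∀ k n → threshold k ≤ n → Bounded k n → BottomBounded (suc k) 0 n
bottom-bounded k n thr≤ previous S len S-in i q∈ _ with ∈-∃++ q∈
... | S₁ , S₂ , refl = begin
  seenNumber n S + loss (suc k)           ≤⟨ +-mono-≤ (seenNumber-bottom n i S₁ S₂) loss≤ ⟩
  seenNumber n S′ + 3 * n + (n + loss k)  ≡⟨ regroup (seenNumber n S′) n (loss k) ⟩
  (seenNumber n S′ + loss k) + 4 * n      ≤⟨ +-monoˡ-≤ (4 * n) (previous S′
                                               (suc-injective (trans (sym (length-middle S₁)) len))
                                               (All.map Box⇒OnBoard (proj₂ (All-middle S₁ S-in)))) ⟩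
  4 * k * n + 4 * n                       ≡⟨ one-more k n ⟩
  4 * suc k * n                           ∎
  where
  open ≤-Reasoning
  S′ = S₁ ++ S₂

  loss≤ : loss (suc k) ≤ n + loss k
  loss≤ = ≤-trans (m∸n≤o⇒m≤n+o (loss (suc k)) (loss k) thr≤) (≤-reflexive (+-comm (loss k) n))

  regroup : ∀ x n l → x + 3 * n + (n + l) ≡ (x + l) + 4 * n
  regroup = solve-∀

  one-more : ∀ k n → 4 * k * n + 4 * n ≡ 4 * suc k * n
  one-more = solve-∀

bounded-grow : ∀ k n → BottomBounded k 0 (2 + n) → Bounded k n → Bounded k (2 + n)
bounded-grow k n bottom previous S len S-on with edge-or-inside S (All.map OnBoard⇒Box S-on)
... | inj₁ (q , q∈ , q-edge) = edge-bound bottom S len (All.map OnBoard⇒Box S-on) q q∈ q-edge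
... | inj₂ inside = begin
  seenNumber (2 + n) S + loss k                     ≤⟨ +-monoˡ-≤ (loss k) (seenNumber-grow n S inside) ⟩
  seenNumber n (map down S) + length S * 8 + loss k ≡⟨ cong (λ l → seenNumber n (map down S) + l * 8 + loss k) len ⟩
  seenNumber n (map down S) + k * 8 + loss k        ≡⟨ +-rightComm (seenNumber n (map down S)) (k * 8) (loss k) ⟩
  (seenNumber n (map down S) + loss k) + k * 8      ≤⟨ +-monoˡ-≤ (k * 8) (previous (map down S)
                                                         (trans (length-map down S) len)
                                                         (All.map⁺ (All.map (proj₂ ∘ Box-down) inside))) ⟩
  4 * k * n + k * 8                                 ≡⟨ two-larger k n ⟩
  4 * k * (2 + n)                                   ∎
  where
  open ≤-Reasoning
  +-rightComm : ∀ x y z → x + y + z ≡ x + z + y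
  +-rightComm = solve-∀

  two-larger : ∀ k n → 4 * k * n + k * 8 ≡ 4 * k * (2 + n)
  two-larger = solve-∀

bounded-induction : ∀ k → Bounded k 11 → Bounded k 12 → (∀ n → BottomBounded k 0 (13 + n)) →
                    ∀ n → Bounded k (11 + n)
bounded-induction k eleven twelve bottom 0             = eleven
bounded-induction k eleven twelve bottom 1             = twelve
bounded-induction k eleven twelve bottom (suc (suc n)) =
  bounded-grow k (11 + n) (bottom n) (bounded-induction k eleven twelve bottom n)

-- A data type, lest comparing types should rerun the searches.
data Checked (k : ℕ) : Set where
  checked : smallBoards k ≡ true → mediumBoards k ≡ true → Checked k

small-checked : ∀ {k s} → Checked k → s < 6 → T (check k s 11) × T (check k s 12)
small-checked {k} {s} (checked small _) s<6 = Equivalence.to (T-∧ {check k s 11})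
  (All.lookup (All.all⁺ (λ s → check k s 11 ∧ check k s 12) (upTo 6) (Equivalence.from T-≡ small)) (∈-upTo⁺ s<6))

medium-checked : ∀ {k n} → Checked k → n < threshold k ∸ 13 → T (check k 0 (13 + n))
medium-checked {k} (checked _ medium) n< =
  All.lookup (All.all⁺ (check k 0) _ (Equivalence.from T-≡ medium)) (∈-applyUpTo⁺ (13 +_) n<)

bounded-step : ∀ k → Checked k → (∀ n → Bounded k (11 + n)) → ∀ n → Bounded (suc k) (11 + n)
bounded-step k chk previous = bounded-induction (suc k)
  (boxes-bounded k 11 6 (n≤1+n 11) (λ {s} s<6 → check-sound k s 11 (proj₁ (small-checked {k} {s} chk s<6))))
  (boxes-bounded k 12 6 ≤-refl     (λ {s} s<6 → check-sound k s 12 (proj₂ (small-checked {k} {s} chk s<6))))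
  bottom
  where
  bottom : ∀ n → BottomBounded (suc k) 0 (13 + n)
  bottom n with n <? threshold k ∸ 13
  ... | yes n< = check-sound k 0 (13 + n) (medium-checked chk n<)
  ... | no  n≮ = bottom-bounded k (13 + n) (m∸n≤o⇒m≤n+o (threshold k) 13 (≮⇒≥ n≮)) (previous (2 + n))

bounded-zero : ∀ n → Bounded 0 n
bounded-zero n [] _ _ = ≤-trans (≤-reflexive (+-identityʳ (seenNumber n [])))
  (seenNumber≤length n [] [] (λ _ ()))

checked-0 : Checked 0
checked-0 = checked refl refl

checked-1 : Checked 1
checked-1 = checked refl refl

checked-2 : Checked 2
checked-2 = checked refl refl

checked-3 : Checked 3
checked-3 = checked refl refl

bounded-four : ∀ n → Bounded 4 (11 + n)
bounded-four = bounded-step 3 checked-3 (bounded-step 2 checked-2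
  (bounded-step 1 checked-1 (bounded-step 0 checked-0 (bounded-zero ∘ (_+_ 11)))))

-- The number of squares seen by C₀

-- `C₀` in coordinates counted from the lower left corner, which is 5 + t below 0 in both
-- coordinates.
optimum : ℕ → List Square
optimum t = (4 + t , 5 + t) ∷ (5 + t , 7 + t) ∷ (6 + t , 4 + t) ∷ (7 + t , 6 + t) ∷ []

-- (a , b) stands for the function t ↦ a + b * t.
Affine : Set
Affine = ℕ × ℕ

_at_ : Affine → ℕ → ℕ
(a , b) at t = a + b * t

AffineSquare : Set
AffineSquare = Affine × Affine

_at²_ : AffineSquare → ℕ → Square
(x , y) at² t = x at t , y at t

_⊕_ : Affine → Affine → Affine
(a , b) ⊕ (a′ , b′) = a + a′ , b + b′

⊕-at : ∀ x y t → (x ⊕ y) at t ≡ x at t + y at t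
⊕-at (a , b) (a′ , b′) t = rearrange a b a′ b′ t
  where
  rearrange : ∀ a b a′ b′ t → (a + a′) + (b + b′) * t ≡ (a + b * t) + (a′ + b′ * t)
  rearrange = solve-∀

_≟ₐ_ : Binary.DecidableEquality Affine
_≟ₐ_ = ≡-dec _≟_ _≟_

_≺_ : Affine → Affine → Set
(a , b) ≺ (a′ , b′) = a < a′ × b ≤ b′

_≺?_ : Binary.Decidable _≺_
(a , b) ≺? (a′ , b′) = a <? a′ ×-dec b ≤? b′

≺-at : ∀ {x y} t → x ≺ y → x at t < y at t
≺-at t (a< , b≤) = +-mono-<-≤ a< (*-monoˡ-≤ t b≤)

-- A decidable certificate that two squares differ for every t, by comparing coefficients in one
-- coordinate.
Apart : AffineSquare → AffineSquare → Set
Apart (x , y) (x′ , y′) = (x ≺ x′ ⊎ x′ ≺ x) ⊎ (y ≺ y′ ⊎ y′ ≺ y)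

apart? : Binary.Decidable Apart
apart? (x , y) (x′ , y′) = (x ≺? x′ ⊎-dec x′ ≺? x) ⊎-dec (y ≺? y′ ⊎-dec y′ ≺? y)

Apart⇒≢ : ∀ {p q} t → Apart p q → p at² t ≢ q at² t
Apart⇒≢ t (inj₁ (inj₁ x≺)) eq = <-irrefl (cong proj₁ eq) (≺-at t x≺)
Apart⇒≢ t (inj₁ (inj₂ x≻)) eq = <-irrefl (cong proj₁ (sym eq)) (≺-at t x≻)
Apart⇒≢ t (inj₂ (inj₁ y≺)) eq = <-irrefl (cong proj₂ eq) (≺-at t y≺)
Apart⇒≢ t (inj₂ (inj₂ y≻)) eq = <-irrefl (cong proj₂ (sym eq)) (≺-at t y≻)

AffineSees : AffineSquare → AffineSquare → Set
AffineSees (i , j) (u , v) = i ≡ u ⊎ j ≡ v ⊎ (i ⊕ v) ≡ (u ⊕ j) ⊎ (i ⊕ j) ≡ (u ⊕ v)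

affineSees? : Binary.Decidable AffineSees
affineSees? (i , j) (u , v) = i ≟ₐ u ⊎-dec j ≟ₐ v ⊎-dec (i ⊕ v) ≟ₐ (u ⊕ j) ⊎-dec (i ⊕ j) ≟ₐ (u ⊕ v)

AffineSees-at : ∀ {q p} t → AffineSees q p → Sees (q at² t) (p at² t)
AffineSees-at t (inj₁ eq) = inj₁ (cong (_at t) eq)
AffineSees-at t (inj₂ (inj₁ eq)) = inj₂ (inj₁ (cong (_at t) eq))
AffineSees-at {i , j} {u , v} t (inj₂ (inj₂ (inj₁ eq))) =
  inj₂ (inj₂ (inj₁ (trans (sym (⊕-at i v t)) (trans (cong (_at t) eq) (⊕-at u j t)))))
AffineSees-at {i , j} {u , v} t (inj₂ (inj₂ (inj₂ eq))) =
  inj₂ (inj₂ (inj₂ (trans (sym (⊕-at i j t)) (trans (cong (_at t) eq) (⊕-at u v t)))))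

-- The last index of the board is m + 2 * t.
module _ (m : ℕ) where

  -- The list ends of the queen (a + t , b + t).
  affineEnds : ℕ × ℕ → List AffineSquare
  affineEnds (a , b) =
    ((a , 1) , (0 , 0)) ∷ ((a , 1) , (m , 2)) ∷ ((0 , 0) , (b , 1)) ∷ ((m , 2) , (b , 1)) ∷
    ((a ∸ b , 0) , (b ∸ a , 0)) ∷ ((m ∸ (b ∸ a) , 2) , (m ∸ (a ∸ b) , 2)) ∷
    (((a + b) ∸ m , 0) , ((a + b) ⊓ m , 2)) ∷ (((a + b) ⊓ m , 2) , ((a + b) ∸ m , 0)) ∷ []

  -- The ring belongs to the board with two more rows, where the queens of `optimum t` have been
  -- moved by `up`; this is why `optimum 1` supplies the constants. Its 4 * 8 entries are the 32 new
  -- squares.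
  affineRing : List AffineSquare
  affineRing = concatMap affineEnds (optimum 1)

  affineOptimum : List AffineSquare
  affineOptimum = map (λ (a , b) → (a , 1) , (b , 1)) (optimum 1)

  -- Each condition is on coefficients alone, so a single evaluation settles every t; it also
  -- certifies that the formulas for the ends give what they should.
  OnAffineRing : AffineSquare → Set
  OnAffineRing p@((a , b) , (c , d)) =
    ((a ≤ m × b ≤ 2) × (c ≤ m × d ≤ 2)) ×
    ((((a , b) ≡ (0 , 0)) ⊎ ((c , d) ≡ (0 , 0))) ⊎ (((a , b) ≡ (m , 2)) ⊎ ((c , d) ≡ (m , 2)))) ×
    Any (λ q → AffineSees q p) affineOptimum

  onAffineRing? : Decidable OnAffineRing
  onAffineRing? p@((a , b) , (c , d)) =
    ((a ≤? m ×-dec b ≤? 2) ×-dec (c ≤? m ×-dec d ≤? 2)) ×-dec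
    (((a , b) ≟ₐ (0 , 0) ⊎-dec (c , d) ≟ₐ (0 , 0)) ⊎-dec ((a , b) ≟ₐ (m , 2) ⊎-dec (c , d) ≟ₐ (m , 2))) ×-dec
    any? (λ q → affineSees? q p) affineOptimum

Sees-up : ∀ {q p} → Sees q p → Sees (up q) (up p)
Sees-up (inj₁ eq) = inj₁ (cong suc eq)
Sees-up (inj₂ (inj₁ eq)) = inj₂ (inj₁ (cong suc eq))
Sees-up {i , j} {u , v} (inj₂ (inj₂ (inj₁ eq))) =
  inj₂ (inj₂ (inj₁ (cong suc (trans (+-suc i v) (trans (cong suc eq) (sym (+-suc u j)))))))
Sees-up {i , j} {u , v} (inj₂ (inj₂ (inj₂ eq))) =
  inj₂ (inj₂ (inj₂ (cong suc (trans (+-suc i j) (trans (cong suc eq) (sym (+-suc u v)))))))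

up-injective : ∀ {p q} → up p ≡ up q → p ≡ q
up-injective refl = refl

∈-seenSquares⁻ : ∀ {n} S {p} → p ∈ seenSquares n S → OnBoard n p × SeenBy S p
∈-seenSquares⁻ {n} S p∈ with ∈-filter⁻ (seenBy? S) {xs = grid n} p∈
... | p∈grid , seen = ∈-grid⁻ p∈grid , seen

-- The counterpart of `seenNumber-grow`: squares moved by `up` stay off the ring, so distinct seen
-- squares on the ring add to them.
seenNumber-ring : ∀ n S ring → Unique ring →
  All (λ p → OnBoard (2 + n) p × OnRing (suc n) p × SeenBy (map up S) p) ring →
  seenNumber n S + length ring ≤ seenNumber (2 + n) (map up S)
seenNumber-ring n S ring ring! ring-seen = ≤-trans
  (≤-reflexive (sym (trans (length-++ (map up (seenSquares n S))) (cong (_+ length ring) (length-map up (seenSquares n S))))))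
  (length-⊆ (++⁺ (map⁺ up-injective (filter⁺ (seenBy? S) (grid-unique n))) ring! disjoint) sub)
  where
  disjoint : ∀ {p} → ¬ (p ∈ map up (seenSquares n S) × p ∈ ring)
  disjoint (p∈ , p∈ring) with ∈-map⁻ up p∈ | All.lookup ring-seen p∈ring
  ... | q , q∈ , refl | _ , inj₁ (inj₁ ()) , _
  ... | q , q∈ , refl | _ , inj₁ (inj₂ ()) , _
  ... | q , q∈ , refl | _ , inj₂ (inj₁ refl) , _ = <-irrefl refl (proj₁ (proj₁ (∈-seenSquares⁻ S q∈)))
  ... | q , q∈ , refl | _ , inj₂ (inj₂ refl) , _ = <-irrefl refl (proj₂ (proj₁ (∈-seenSquares⁻ S q∈)))

  seen-up : ∀ {S p} → SeenBy S p → SeenBy (map up S) (up p)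
  seen-up = Any.map⁺ ∘ Any.map Sees-up

  sub : map up (seenSquares n S) ++ ring ⊆ seenSquares (2 + n) (map up S)
  sub p∈ with ∈-++⁻ (map up (seenSquares n S)) p∈
  sub p∈ | inj₂ p∈ring with All.lookup ring-seen p∈ring
  ... | p-on , _ , seen = ∈-seenSquares p-on seen
  sub p∈ | inj₁ p∈map with ∈-map⁻ up p∈map
  ... | q , q∈ , refl with ∈-seenSquares⁻ S q∈
  ... | (i< , j<) , seen = ∈-seenSquares (s≤s (m≤n⇒m≤1+n i<) , s≤s (m≤n⇒m≤1+n j<)) (seen-up seen)

module _ (n₀ : ℕ) (base : 16 * n₀ ∸ 72 ≤ seenNumber n₀ (optimum 0)) (72≤16n₀ : 72 ≤ 16 * n₀)
         (ring-apart : AllPairs Apart (affineRing (suc n₀)))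
         (ring-on    : All (OnAffineRing (suc n₀)) (affineRing (suc n₀))) where

  size : ℕ → ℕ
  size t = n₀ + 2 * t

  ring : ℕ → List Square
  ring t = map (_at² t) (affineRing (suc n₀))

  affineOptimum-at : ∀ t → map (_at² t) (affineOptimum (suc n₀)) ≡ map up (optimum t)
  affineOptimum-at t rewrite +-identityʳ t = refl

  ring-seen : ∀ t → All (λ p → OnBoard (2 + size t) p × OnRing (suc (size t)) p × SeenBy (map up (optimum t)) p) (ring t)
  ring-seen t = All.map⁺ (All.map (λ { {p} (((a≤ , b≤) , (c≤ , d≤)) , edge , seen) →
      (s≤s (+-mono-≤ a≤ (*-monoˡ-≤ t b≤)) , s≤s (+-mono-≤ c≤ (*-monoˡ-≤ t d≤))) ,
      on-ring edge ,
      subst (λ S → SeenBy S (p at² t)) (affineOptimum-at t) (Any.map⁺ (Any.map (λ {q} → AffineSees-at {q} {p} t) seen)) }) ring-on)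
    where
    on-ring : ∀ {x y} → (x ≡ (0 , 0) ⊎ y ≡ (0 , 0)) ⊎ (x ≡ (suc n₀ , 2) ⊎ y ≡ (suc n₀ , 2)) →
              OnRing (suc (size t)) ((x , y) at² t)
    on-ring (inj₁ (inj₁ refl)) = inj₁ (inj₁ refl)
    on-ring (inj₁ (inj₂ refl)) = inj₁ (inj₂ refl)
    on-ring (inj₂ (inj₁ refl)) = inj₂ (inj₁ refl)
    on-ring (inj₂ (inj₂ refl)) = inj₂ (inj₂ refl)

  ring-unique : ∀ t → Unique (ring t)
  ring-unique t = AllPairs.map⁺ (AllPairs.map (Apart⇒≢ t) ring-apart)

  seenNumber-optimum : ∀ t → 16 * size t ≤ seenNumber (size t) (optimum t) + 72
  seenNumber-optimum zero = subst (λ n → 16 * n ≤ seenNumber n (optimum 0) + 72) (sym (+-identityʳ n₀))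
    (≤-trans (≤-reflexive (sym (m∸n+n≡m 72≤16n₀))) (+-monoˡ-≤ 72 base))
  seenNumber-optimum (suc t) = subst (λ n → 16 * n ≤ seenNumber n (optimum (suc t)) + 72) (grow n₀ t) (begin
    16 * (2 + size t)                                      ≡⟨ rearrange (size t) ⟩
    16 * size t + 32                                       ≤⟨ +-monoˡ-≤ 32 (seenNumber-optimum t) ⟩
    seenNumber (size t) (optimum t) + 72 + 32              ≡⟨ rearrange′ (seenNumber (size t) (optimum t)) ⟩
    (seenNumber (size t) (optimum t) + length (ring t)) + 72
      ≤⟨ +-monoˡ-≤ 72 (seenNumber-ring (size t) (optimum t) (ring t) (ring-unique t) (ring-seen t)) ⟩
    seenNumber (2 + size t) (optimum (suc t)) + 72         ∎)
    where
    open ≤-Reasoning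
    grow : ∀ n t → 2 + (n + 2 * t) ≡ n + 2 * suc t
    grow = solve-∀
    rearrange : ∀ n → 16 * (2 + n) ≡ 16 * n + 32
    rearrange = solve-∀
    rearrange′ : ∀ x → x + 72 + 32 ≡ (x + 32) + 72
    rearrange′ = solve-∀

seenNumber-optimum-odd : ∀ t → 16 * (11 + 2 * t) ≤ seenNumber (11 + 2 * t) (optimum t) + 72
-- Here 104 is 16 * 11 - 72 and 176 is 16 * 11. The ring is that of the board with 13 rows, whose
-- last index is 12.
seenNumber-optimum-odd = seenNumber-optimum 11 (≤ᵇ⇒≤ 104 _ _) (≤ᵇ⇒≤ 72 176 _)
  (from-yes (allPairs? apart? (affineRing 12))) (from-yes (All.all? (onAffineRing? 12) (affineRing 12)))

seenNumber-optimum-even : ∀ t → 16 * (12 + 2 * t) ≤ seenNumber (12 + 2 * t) (optimum t) + 72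
seenNumber-optimum-even = seenNumber-optimum 12 (≤ᵇ⇒≤ 120 _ _) (≤ᵇ⇒≤ 72 192 _)
  (from-yes (allPairs? apart? (affineRing 13))) (from-yes (All.all? (onAffineRing? 13) (affineRing 13)))

-- Squares as points of ℤ × ℤ

open import Data.Integer as ℤ using (ℤ; +_; -[1+_]; 0ℤ)
open import Data.Integer.DivMod using (_/ℕ_)
import Data.Integer.Properties as ℤ
open import Algebra.Properties.AbelianGroup ℤ.+-0-abelianGroup using (∙-cancelˡ)
import Data.Integer.Tactic.RingSolver as ℤ

private
  x-y≡0⇒x≡y : ∀ {x y} → + x ℤ.- + y ≡ 0ℤ → x ≡ y
  x-y≡0⇒x≡y eq = ℤ.+-injective (ℤ.i-j≡0⇒i≡j _ _ eq)

module Translation (lo : ℤ) where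

  coordinate : ℕ → ℤ
  coordinate i = lo ℤ.+ + i

  coordinate-injective : ∀ {i j} → coordinate i ≡ coordinate j → i ≡ j
  coordinate-injective eq = ℤ.+-injective (∙-cancelˡ lo _ _ eq)

  place : Square → Point
  place (i , j) = coordinate i , coordinate j

  place-injective : ∀ {p q} → place p ≡ place q → p ≡ q
  place-injective eq = cong₂ _,_ (coordinate-injective (cong proj₁ eq)) (coordinate-injective (cong proj₂ eq))

  shifted : ∀ {u i k} → coordinate u ≡ coordinate i ℤ.+ k → + u ≡ + i ℤ.+ k
  shifted {u} {i} {k} eq = ∙-cancelˡ lo _ _ (trans eq (ℤ.+-assoc lo (+ i) k))

  shift : ∀ u i → coordinate u ≡ coordinate i ℤ.+ (+ u ℤ.- + i)
  shift u i = cancel lo (+ u) (+ i)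
    where
    cancel : ∀ l u i → l ℤ.+ u ≡ l ℤ.+ i ℤ.+ (u ℤ.- i)
    cancel = ℤ.solve-∀

  Reaches⇒Sees : ∀ {q k p} → Reaches (place q) k (place p) → Sees q p
  Reaches⇒Sees (inj₁ eq) = inj₂ (inj₁ (coordinate-injective (sym (cong proj₂ eq))))
  Reaches⇒Sees (inj₂ (inj₁ eq)) = inj₁ (coordinate-injective (sym (cong proj₁ eq)))
  Reaches⇒Sees {i , j} {k} {u , v} (inj₂ (inj₂ (inj₁ eq))) = inj₂ (inj₂ (inj₁ (ℤ.+-injective (begin
    + i ℤ.+ + v           ≡⟨ cong (ℤ._+_ (+ i)) (shifted (cong proj₂ eq)) ⟩
    + i ℤ.+ (+ j ℤ.+ k)   ≡⟨ rearrange (+ i) (+ j) k ⟩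
    + i ℤ.+ k ℤ.+ + j     ≡⟨ cong (ℤ._+ + j) (shifted (cong proj₁ eq)) ⟨
    + u ℤ.+ + j           ∎))))
    where
    open ≡-Reasoning
    rearrange : ∀ i j k → i ℤ.+ (j ℤ.+ k) ≡ i ℤ.+ k ℤ.+ j
    rearrange = ℤ.solve-∀
  Reaches⇒Sees {i , j} {k} {u , v} (inj₂ (inj₂ (inj₂ eq))) = inj₂ (inj₂ (inj₂ (ℤ.+-injective (begin
    + i ℤ.+ + j                       ≡⟨ rearrange (+ i) (+ j) k ⟩
    (+ i ℤ.+ k) ℤ.+ (+ j ℤ.- k)       ≡⟨ cong₂ ℤ._+_ (shifted (cong proj₁ eq)) (shifted (cong proj₂ eq)) ⟨
    + u ℤ.+ + v                       ∎))))
    where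
    open ≡-Reasoning
    rearrange : ∀ i j k → i ℤ.+ j ≡ (i ℤ.+ k) ℤ.+ (j ℤ.- k)
    rearrange = ℤ.solve-∀

  -- The step is a difference of coordinates. It must be nonzero, so equal coordinates are split off
  -- before the kind of line is inspected.
  Sees⇒A₁ : ∀ {q p} → Sees q p → place p ≡ place q ⊎ A₁ (place q) (place p)
  Sees⇒A₁ {i , j} {u , v} seen with i ≟ u | j ≟ v
  ... | yes refl | yes refl = inj₁ refl
  Sees⇒A₁ {i , j} {u , v} _ | yes refl | no j≢v =
    inj₂ (+ v ℤ.- + j , (j≢v ∘ sym ∘ x-y≡0⇒x≡y) , inj₂ (inj₁ (cong (coordinate u ,_) (shift v j))))
  Sees⇒A₁ {i , j} {u , v} _ | no i≢u | yes refl =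
    inj₂ (+ u ℤ.- + i , (i≢u ∘ sym ∘ x-y≡0⇒x≡y) , inj₁ (cong (_, coordinate v) (shift u i)))
  Sees⇒A₁ (inj₁ i≡u) | no i≢u | no _ = contradiction i≡u i≢u
  Sees⇒A₁ (inj₂ (inj₁ j≡v)) | no _ | no j≢v = contradiction j≡v j≢v
  Sees⇒A₁ {i , j} {u , v} (inj₂ (inj₂ (inj₁ dia))) | no i≢u | no _ =
    inj₂ (+ u ℤ.- + i , (i≢u ∘ sym ∘ x-y≡0⇒x≡y) , inj₂ (inj₂ (inj₁ (cong₂ _,_ (shift u i)
      (trans (shift v j) (cong (ℤ._+_ (coordinate j)) difference))))))
    where
    difference : + v ℤ.- + j ≡ + u ℤ.- + i
    difference = begin
      + v ℤ.- + j                          ≡⟨ rearrange (+ v) (+ j) (+ i) ⟩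
      (+ i ℤ.+ + v) ℤ.- (+ i ℤ.+ + j)      ≡⟨ cong (λ x → + x ℤ.- (+ i ℤ.+ + j)) dia ⟩
      (+ u ℤ.+ + j) ℤ.- (+ i ℤ.+ + j)      ≡⟨ rearrange′ (+ u) (+ j) (+ i) ⟩
      + u ℤ.- + i                          ∎
      where
      open ≡-Reasoning
      rearrange : ∀ v j i → v ℤ.- j ≡ (i ℤ.+ v) ℤ.- (i ℤ.+ j)
      rearrange = ℤ.solve-∀
      rearrange′ : ∀ u j i → (u ℤ.+ j) ℤ.- (i ℤ.+ j) ≡ u ℤ.- i
      rearrange′ = ℤ.solve-∀
  Sees⇒A₁ {i , j} {u , v} (inj₂ (inj₂ (inj₂ ant))) | no i≢u | no _ =
    inj₂ (+ u ℤ.- + i , (i≢u ∘ sym ∘ x-y≡0⇒x≡y) , inj₂ (inj₂ (inj₂ (cong₂ _,_ (shift u i)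
      (trans (shift v j) (cong (ℤ._+_ (coordinate j)) difference))))))
    where
    difference : + v ℤ.- + j ≡ ℤ.- (+ u ℤ.- + i)
    difference = begin
      + v ℤ.- + j                          ≡⟨ rearrange (+ v) (+ j) (+ u) ⟩
      (+ u ℤ.+ + v) ℤ.- (+ u ℤ.+ + j)      ≡⟨ cong (λ x → + x ℤ.- (+ u ℤ.+ + j)) ant ⟨
      (+ i ℤ.+ + j) ℤ.- (+ u ℤ.+ + j)      ≡⟨ rearrange′ (+ u) (+ j) (+ i) ⟩
      ℤ.- (+ u ℤ.- + i)                    ∎
      where
      open ≡-Reasoning
      rearrange : ∀ v j u → v ℤ.- j ≡ (u ℤ.+ v) ℤ.- (u ℤ.+ j)
      rearrange = ℤ.solve-∀
      rearrange′ : ∀ u j i → (i ℤ.+ j) ℤ.- (u ℤ.+ j) ≡ ℤ.- (u ℤ.- i)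
      rearrange′ = ℤ.solve-∀

  module _ (n : ℕ) (I≡ : I n ≡ map coordinate (upTo n)) where

    ∈-B⁺ : ∀ {p} → OnBoard n p → place p ∈ B n
    ∈-B⁺ (i< , j<) = ∈-cartesianProduct⁺ (∈-I i<) (∈-I j<)
      where
      ∈-I : ∀ {i} → i < n → coordinate i ∈ I n
      ∈-I i< = subst (_ ∈_) (sym I≡) (∈-map⁺ coordinate (∈-upTo⁺ i<))

    ∈-B⁻ : ∀ {P} → P ∈ B n → ∃[ p ] OnBoard n p × P ≡ place p
    ∈-B⁻ P∈ with ∈-cartesianProduct⁻ (I n) (I n) P∈
    ... | x∈ , y∈ with ∈-map⁻ coordinate (subst (_ ∈_) I≡ x∈) | ∈-map⁻ coordinate (subst (_ ∈_) I≡ y∈)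
    ... | i , i∈ , refl | j , j∈ , refl = (i , j) , (∈-upTo⁻ i∈ , ∈-upTo⁻ j∈) , refl

    squares : ∀ Ps → Ps ⊆ B n → ∃[ S ] All (OnBoard n) S × Ps ≡ map place S
    squares []       _    = [] , [] , refl
    squares (P ∷ Ps) Ps⊆B with ∈-B⁻ (Ps⊆B (here refl)) | squares Ps (Ps⊆B ∘ there)
    ... | p , p-on , refl | S , S-on , refl = p ∷ S , p-on ∷ S-on , refl

    cover≤seenNumber : ∀ C S → points C ≡ map place S → cover n C ≤ seenNumber n S
    cover≤seenNumber C S C≡ = ≤-trans (length-⊆ (filter⁺ (Covered? C) (B-unique n)) sub)
                                      (≤-reflexive (length-map place (seenSquares n S)))
      where
      seen : ∀ {p} → Covered C (place p) → SeenBy S p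
      seen {p} (inj₁ p∈) with ∈-map⁻ place (subst (place p ∈_) C≡ p∈)
      ... | q , q∈ , eq = lose q∈ (inj₁ (cong proj₁ (place-injective {q} {p} (sym eq))))
      seen {p} (inj₂ attacked) = Any.map (λ (_ , _ , r) → Reaches⇒Sees r)
        (Any.map⁻ (subst (Any (λ Q → A₁ Q (place p))) C≡ attacked))

      sub : filter (Covered? C) (B n) ⊆ map place (seenSquares n S)
      sub P∈ with ∈-filter⁻ (Covered? C) {xs = B n} P∈
      ... | P∈B , covered with ∈-B⁻ P∈B
      ... | p , p-on , refl = ∈-map⁺ place (∈-seenSquares p-on (seen covered))

    seenNumber≤cover : ∀ C S → points C ≡ map place S → seenNumber n S ≤ cover n C
    seenNumber≤cover C S C≡ = ≤-trans (≤-reflexive (sym (length-map place (seenSquares n S))))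
      (length-⊆ (map⁺ place-injective (filter⁺ (seenBy? S) (grid-unique n))) sub)
      where
      covered : ∀ {p} → SeenBy S p → Covered C (place p)
      covered {p} seen with find seen
      ... | q , q∈ , s with Sees⇒A₁ {q} {p} s
      ... | inj₁ eq       = inj₁ (subst (place p ∈_) (sym C≡) (subst (_∈ map place S) (sym eq) (∈-map⁺ place q∈)))
      ... | inj₂ attacked = inj₂ (subst (Any (λ Q → A₁ Q (place p))) (sym C≡) (lose (∈-map⁺ place q∈) attacked))

      sub : map place (seenSquares n S) ⊆ filter (Covered? C) (B n)
      sub P∈ with ∈-map⁻ place P∈
      ... | p , p∈ , refl with ∈-seenSquares⁻ S p∈
      ... | p-on , seen = ∈-filter⁺ (Covered? C) (∈-B⁺ p-on) (covered seen)

    module _ (S₀ : List Square) (C₀≡ : points C₀ ≡ map place S₀) (S₀-on : All (OnBoard n) S₀)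
             (lower : 16 * n ≤ seenNumber n S₀ + 72) (upper : Bounded 4 n) where

      C₀-optimal : Optimal n 4 C₀
      C₀-optimal = record
        { size    = refl
        ; inBoard = λ P∈ → in-board (subst (_ ∈_) C₀≡ P∈)
        ; maximal = maximal
        }
        where
        in-board : ∀ {P} → P ∈ map place S₀ → P ∈ B n
        in-board P∈ with ∈-map⁻ place P∈
        ... | p , p∈ , refl = ∈-B⁺ (All.lookup S₀-on p∈)

        maximal : ∀ C → ∣ C ∣ ≡ 4 → points C ⊆ B n → cover n C ≤ cover n C₀
        maximal C len C⊆B with squares (points C) C⊆B
        ... | S , S-on , C≡ = begin
          cover n C       ≤⟨ cover≤seenNumber C S C≡ ⟩
          seenNumber n S  ≤⟨ +-cancelʳ-≤ 72 _ _ (≤-trans (upper S len′ S-on) lower) ⟩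
          seenNumber n S₀ ≤⟨ seenNumber≤cover C₀ S₀ C₀≡ ⟩
          cover n C₀      ∎
          where
          open ≤-Reasoning
          len′ : length S ≡ 4
          len′ = trans (sym (length-map place S)) (trans (cong length (sym C≡)) len)

-- The board as an interval of integers

half : ∀ r q → r < 2 → (r + q * 2) / 2 ≡ q
half r q r<2 = trans (+-distrib-/-∣ʳ r (n∣m*n q)) (cong₂ _+_ (m<n⇒m/n≡0 r<2) (m*n/n≡m q 2))

remainder : ∀ r q → r < 2 → (r + q * 2) % 2 ≡ r
remainder r q r<2 = trans ([m+kn]%n≡m%n r q 2) (m<n⇒m%n≡m r<2)

-- The floor of a negative quotient branches on the remainder of the absolute value, which must be
-- known before anything reduces.
halve-negative-even : ∀ k q → suc k ≡ q * 2 → -[1+ k ] /ℕ 2 ≡ ℤ.- (+ q)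
halve-negative-even k q eq with suc k % 2 | trans (cong (_% 2) eq) (remainder 0 q z<s)
... | zero | refl = cong (λ x → ℤ.- (+ x)) (trans (cong (_/ 2) eq) (half 0 q z<s))

halve-negative-odd : ∀ k q → suc k ≡ 1 + q * 2 → -[1+ k ] /ℕ 2 ≡ -[1+ q ]
halve-negative-odd k q eq with suc k % 2 | trans (cong (_% 2) eq) (remainder 1 q (s≤s z<s))
... | suc zero | refl = cong -[1+_] (trans (cong (_/ 2) eq) (half 1 q (s≤s z<s)))

interval-upTo : ∀ lo hi d → hi ≡ lo ℤ.+ + d → interval lo hi ≡ map (λ i → lo ℤ.+ + i) (upTo (suc d))
interval-upTo lo hi d refl = cong (countUp lo) (cancel lo (+ d))
  where
  cancel : ∀ l d → l ℤ.+ d ℤ.- l ≡ d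
  cancel = ℤ.solve-∀

module _ (t : ℕ) where

  -- The boards with 11 + 2 t and 12 + 2 t rows both start here, so one `optimum t` serves both
  -- parities; the even board extends one further at the other end.
  lo : ℤ
  lo = -[1+ 4 + t ]

  open Translation lo

  lo+ : ∀ c → lo ℤ.+ + (c + (5 + t)) ≡ + c
  lo+ c = trans (cong (λ x → lo ℤ.+ x) (ℤ.pos-+ c (5 + t))) (cancel (+ c) (+ (5 + t)))
    where
    cancel : ∀ c h → ℤ.- h ℤ.+ (c ℤ.+ h) ≡ c
    cancel = ℤ.solve-∀

  lo+-pred : lo ℤ.+ + (4 + t) ≡ ℤ.-1ℤ
  lo+-pred = cancel (+ (4 + t))
    where
    cancel : ∀ h → ℤ.- (ℤ.1ℤ ℤ.+ h) ℤ.+ h ≡ ℤ.-1ℤ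
    cancel = ℤ.solve-∀

  C₀≡ : points C₀ ≡ map place (optimum t)
  C₀≡ = sym (cong₂ _∷_ (cong₂ _,_ lo+-pred (lo+ 0)) (cong₂ _∷_ (cong₂ _,_ (lo+ 0) (lo+ 2))
    (cong₂ _∷_ (cong₂ _,_ (lo+ 1) lo+-pred) (cong₂ _∷_ (cong₂ _,_ (lo+ 2) (lo+ 1)) refl))))

  I-interval : ∀ n hi → (+ 2 ℤ.- + suc n) /ℕ 2 ≡ lo → + suc n /ℕ 2 ≡ hi → hi ≡ lo ℤ.+ + n →
               I (suc n) ≡ map coordinate (upTo (suc n))
  I-interval n hi lo≡ hi≡ d≡ = trans (cong₂ interval lo≡ hi≡) (interval-upTo lo hi n d≡)

  double : ∀ r t → r + 2 * t ≡ r + t * 2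
  double r t = cong (_+_ r) (*-comm 2 t)

  I-odd : I (11 + 2 * t) ≡ map coordinate (upTo (11 + 2 * t))
  I-odd = I-interval (10 + 2 * t) (+ (5 + t))
    -- 2 - n is -(9 + 2 t), and half of it rounds down to -(5 + t).
    (halve-negative-odd (8 + 2 * t) (4 + t) (double 9 t))
    (cong +_ (trans (cong (_/ 2) (double 11 t)) (half 1 (5 + t) (s≤s z<s))))
    (sym (trans (cong (λ x → lo ℤ.+ + x) (rearrange t)) (lo+ (5 + t))))
    where
    rearrange : ∀ t → 10 + 2 * t ≡ (5 + t) + (5 + t)
    rearrange = solve-∀

  I-even : I (12 + 2 * t) ≡ map coordinate (upTo (12 + 2 * t))
  I-even = I-interval (11 + 2 * t) (+ (6 + t))
    (halve-negative-even (9 + 2 * t) (5 + t) (double 10 t))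
    (cong +_ (trans (cong (_/ 2) (double 12 t)) (half 0 (6 + t) z<s)))
    (sym (trans (cong (λ x → lo ℤ.+ + x) (rearrange t)) (lo+ (6 + t))))
    where
    rearrange : ∀ t → 11 + 2 * t ≡ (6 + t) + (5 + t)
    rearrange = solve-∀

  optimum-on : ∀ n → 8 + t ≤ n → All (OnBoard n) (optimum t)
  optimum-on n ≤n =
    (at 3 refl , at 2 refl) ∷ (at 2 refl , at 0 refl) ∷ (at 1 refl , at 3 refl) ∷ (at 0 refl , at 1 refl) ∷ []
    where
    at : ∀ {i} c → c + suc i ≡ 8 + t → i < n
    at c eq = ≤-trans (≤-trans (m≤n+m _ c) (≤-reflexive eq)) ≤n

odd-or-even : ∀ n → (∃[ t ] n ≡ 2 * t) ⊎ (∃[ t ] n ≡ suc (2 * t))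
odd-or-even zero = inj₁ (0 , refl)
odd-or-even (suc n) with odd-or-even n
... | inj₁ (t , refl) = inj₂ (t , refl)
... | inj₂ (t , refl) = inj₁ (suc t , cong suc (sym (+-suc t (t + 0))))

C₀-optimal-from-11 : ∀ {d} → (∃[ t ] d ≡ 2 * t) ⊎ (∃[ t ] d ≡ suc (2 * t)) → Optimal (11 + d) 4 C₀
C₀-optimal-from-11 (inj₁ (t , refl)) = Translation.C₀-optimal (lo t) (11 + 2 * t) (I-odd t) (optimum t) (C₀≡ t)
  (optimum-on t (11 + 2 * t) (+-mono-≤ (m≤n+m 8 3) (m≤m+n t (t + 0))))
  (seenNumber-optimum-odd t) (bounded-four (2 * t))
C₀-optimal-from-11 (inj₂ (t , refl)) = Translation.C₀-optimal (lo t) (12 + 2 * t) (I-even t) (optimum t) (C₀≡ t)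
  (optimum-on t (12 + 2 * t) (+-mono-≤ (m≤n+m 8 4) (m≤m+n t (t + 0))))
  (seenNumber-optimum-even t) (bounded-four (suc (2 * t)))

mainTheorem3 : (n : ℕ) → n > 10 → Optimal n 4 C₀
mainTheorem3 n n>10 =
  subst (λ n → Optimal n 4 C₀) (m+[n∸m]≡n n>10) (C₀-optimal-from-11 (odd-or-even (n ∸ 11)))
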